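{- Let $S>0$ and let $D=(D[1],\dots,D[n])$ be a vector of demands with $0<D[i]\le S$ for all $i$. Then there exists an integer $k$ with $1\le k\le a(n)$ such that the egalitarian connection-time of the electricity division instance $(S,D)$ equals $\frac{k}{OPT(D_k)}$. Moreover, this value is attained by taking an optimal $k$-times bin packing of $D$ (with $OPT(D_k)$ bins) and connecting the set of households in each bin during a fraction $\frac{1}{OPT(D_k)}$ of the time interval (the bins being connected during pairwise disjoint subintervals).
   Context: Electricity division: there is a supply $S>0$, $n$ households with demands $D[1],\dots,D[n]$, and a time interval $[0,T]$. A schedule is a partition of $[0,T]$ into finitely many subintervals $I_1,\dots,I_p$ together with sets $A_1,\dots,A_p\subseteq\{1,\dots,n\}$ such that $\sum_{i\in A_l}D[i]\le S$ for each $l$; household $i$ receives connection time $u_i=\sum_{l:\,i\in A_l}|I_l|$. The egalitarian connection-time is $\max_{\text{schedules}}\min_i u_i/T$ (the largest fraction of the time that every household can simultaneously be guaranteed). $k$-times bin packing: given a bin capacity $S$, items $1,\dots,n$ with sizes $D[i]$, and an integer $k\ge1$, $D_k$ denotes the collection of $k$ copies of each item; a $k$-times bin packing is an assignment of all copies in $D_k$ to bins such that the total size in each bin is at most $S$ and no bin contains two copies of the same item (so each item lies in exactly $k$ distinct bins). $OPT(D_k)$ is the minimum number of bins of a $k$-times bin packing. For a positive integer $n$, $a(n)$ denotes the maximum determinant of an $n\times n$ matrix all of whose entries are $0$ or $1$. -}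

module Defs where

open import Level using (Level; _⊔_) renaming (suc to lsuc)
open import Algebra.Bundles using (CommutativeRing)
open import Algebra.Structures using (IsCommutativeRing)
import Algebra.Definitions.RawMonoid as RawMonoidDefinitions
open import Data.Bool.Base using (if_then_else_)
open import Data.Fin.Base using (Fin; zero; suc; inject₁; fromℕ; toℕ; punchIn)
import Data.Fin.Properties as Fin
open import Data.Fin.Subset using (Subset)
open import Data.Integer.Base as ℤ using (ℤ; 0ℤ; 1ℤ; -1ℤ)
open import Data.Nat.Base as ℕ using (ℕ)
open import Data.Product.Base using (∃-syntax; _×_)
open import Data.Sum.Base using (_⊎_)
open import Data.Vec.Base using (lookup; tabulate)
open import Function.Base using (flip)
open import Function.Definitions using (Injective)
open import Relation.Binary.Core using (Rel)
import Relation.Binary.Construct.StrictToNonStrict as StrictToNonStrict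
open import Relation.Binary.PropositionalEquality.Core using (_≡_)
open import Relation.Binary.Structures using (IsStrictTotalOrder)
open import Relation.Nullary.Decidable.Core using (does)
open import Relation.Nullary.Negation.Core using (¬_)
open import Relation.Unary using (Pred)

IsMinimumOf : ∀ {a ℓ p} {A : Set a} → Rel A ℓ → Pred A p → Pred A (a ⊔ ℓ ⊔ p)
IsMinimumOf _≤_ P m = P m × (∀ x → P x → m ≤ x)

IsMaximumOf : ∀ {a ℓ p} {A : Set a} → Rel A ℓ → Pred A p → Pred A (a ⊔ ℓ ⊔ p)
IsMaximumOf _≤_ = IsMinimumOf (flip _≤_)

Matrix : ℕ → Set
Matrix n = Fin n → Fin n → ℤ

-- Laplace expansion along the first row.
det : ∀ {n} → Matrix n → ℤ
det {ℕ.zero}  M = 1ℤ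
det {ℕ.suc n} M = sum λ j →
  (-1ℤ ℤ.^ toℕ j) ℤ.* M zero j ℤ.* det (λ r c → M (suc r) (punchIn j c))
  where open RawMonoidDefinitions ℤ.+-0-rawMonoid using (sum)

ZeroOne : ∀ {n} → Matrix n → Set
ZeroOne M = ∀ i j → M i j ≡ 0ℤ ⊎ M i j ≡ 1ℤ

-- a(n) is the unique integer satisfying this predicate.
IsMaxDet01 : ℕ → ℤ → Set
IsMaxDet01 n = IsMaximumOf ℤ._≤_ λ d → ∃[ M ] ZeroOne {n} M × det M ≡ d

-- The real numbers enter only through the axioms of a linearly ordered field.
-- The inverse is a total operation whose value at 0# is unconstrained.
record OrderedField (c ℓ₁ ℓ₂ : Level) : Set (lsuc (c ⊔ ℓ₁ ⊔ ℓ₂)) where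
  infix  8 -_
  infix  9 _⁻¹
  infixl 7 _*_
  infixl 6 _+_
  infix  4 _≈_ _<_
  field
    Carrier            : Set c
    _≈_                : Rel Carrier ℓ₁
    _<_                : Rel Carrier ℓ₂
    _+_ _*_            : Carrier → Carrier → Carrier
    -_ _⁻¹             : Carrier → Carrier
    0# 1#              : Carrier
    isCommutativeRing  : IsCommutativeRing _≈_ _+_ _*_ -_ 0# 1#
    isStrictTotalOrder : IsStrictTotalOrder _≈_ _<_
    0<1                : 0# < 1#
    +-monoʳ-<          : ∀ x {y z} → y < z → x + y < x + z
    *-pos              : ∀ {x y} → 0# < x → 0# < y → 0# < x * y
    *-inverseʳ         : ∀ x → ¬ (x ≈ 0#) → x * x ⁻¹ ≈ 1#

  commutativeRing : CommutativeRing c ℓ₁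
  commutativeRing = record { isCommutativeRing = isCommutativeRing }

  open CommutativeRing commutativeRing public
    using (_-_; +-rawMonoid)

  open StrictToNonStrict _≈_ _<_ public using (_≤_)

  open RawMonoidDefinitions +-rawMonoid public
    using (sum) renaming (_×_ to _·_)

  infixl 7 _/_ _÷_
  _/_ : Carrier → Carrier → Carrier
  x / y = x * y ⁻¹

  _÷_ : ℕ → ℕ → Carrier
  k ÷ m = (k · 1#) / (m · 1#)

module _ {c ℓ₁ ℓ₂} (F : OrderedField c ℓ₁ ℓ₂) where
  open OrderedField F

  module ElectricityDivision
    {n : ℕ} (S : Carrier) (D : Fin n → Carrier) (T : Carrier) where

    load : Subset n → Carrier
    load A = sum λ i → if lookup A i then D i else 0#

    -- The subintervals are listed from left to right:
    -- the l-th one lies between breakpoints l and l + 1.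
    record Schedule (p : ℕ) : Set (c ⊔ ℓ₁ ⊔ ℓ₂) where
      field
        breakpoint : Fin (ℕ.suc p) → Carrier
        start      : breakpoint zero ≈ 0#
        end        : breakpoint (fromℕ p) ≈ T
        increasing : ∀ l → breakpoint (inject₁ l) < breakpoint (suc l)
        connected  : Fin p → Subset n
        feasible   : ∀ l → load (connected l) ≤ S

      duration : Fin p → Carrier
      duration l = breakpoint (suc l) - breakpoint (inject₁ l)

      connectionTime : Fin n → Carrier
      connectionTime i = sum λ l → if lookup (connected l) i then duration l else 0#

    open Schedule public

    IsEgalitarianValue : ∀ {p} → Schedule p → Pred Carrier (c ⊔ ℓ₁ ⊔ ℓ₂)
    IsEgalitarianValue σ = IsMinimumOf _≤_ λ x → ∃[ i ] x ≈ connectionTime σ i / T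

    IsEgalitarianConnectionTime : Pred Carrier (c ⊔ ℓ₁ ⊔ ℓ₂)
    IsEgalitarianConnectionTime =
      IsMaximumOf _≤_ λ v → ∃[ p ] ∃[ σ ] IsEgalitarianValue {p} σ v

    -- Fin n × Fin k (curried) indexes the copies in D_k, and Fin m the bins.
    record Packing (k m : ℕ) : Set (ℓ₁ ⊔ ℓ₂) where
      field
        bin      : Fin n → Fin k → Fin m
        distinct : ∀ i → Injective _≡_ _≡_ (bin i)
        capacity : ∀ b → sum (λ i → sum λ j →
                     if does (bin i j Fin.≟ b) then D i else 0#) ≤ S

      contents : Fin m → Subset n
      contents b = tabulate λ i → does (Fin.any? λ j → bin i j Fin.≟ b)

    open Packing public

    IsOPT : ℕ → ℕ → Set (ℓ₁ ⊔ ℓ₂)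
    IsOPT k = IsMinimumOf ℕ._≤_ (Packing k)

    Follows : ∀ {k m} → Schedule m → Packing k m → Set ℓ₁
    Follows {m = m} σ f =
      ∀ l → connected σ l ≡ contents f l × duration σ l ≈ (1 ÷ m) * T

{-# OPTIONS --safe #-}
-- Consider the weights on feasible sets that cover every household with total weight at least t.
-- Such a fractional cover can be made basic without increasing its total weight: add the sets to
-- a basis one at a time, each time moving along the kernel vector of maximal minors of the
-- n × (n + 1) matrix of columns until some weight vanishes, and drop that column. By Cramer's rule
-- the weights of a basic cover are t q / k with natural numbers q and k = |det| of the basis, and
-- k ≤ a(n) because the basis is a 0/1 matrix up to the signs of its columns. Finitely many bases
-- exist; in the best one, taking each set q times gives a k-times bin packing with m bins. Every
-- schedule and every k-times bin packing is a fractional cover, so none beats the ratio k / m.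
module Submission where

open import Defs
open import Data.Nat.Base as ℕ using (ℕ; NonZero)
open import Data.Integer.Base as ℤ using (+_)
open import Data.Fin.Base using (Fin)
open import Data.Product.Base using (∃-syntax; _×_)

open import Algebra.Bundles using (CommutativeRing)
import Algebra.Properties.CommutativeMonoid.Sum
import Algebra.Properties.Ring
import Algebra.Properties.Semiring.Mult
import Algebra.Properties.Semiring.Sum
import Algebra.Solver.Ring
import Algebra.Solver.Ring.AlmostCommutativeRing as ACR
open import Data.Bool.Base using (Bool; true; false; if_then_else_)
open import Data.Empty using (⊥-elim)
open import Data.Fin.Base using (zero; suc; toℕ; punchIn; splitAt; inject₁; fromℕ; fromℕ<)
import Data.Fin.Properties as Fin
open import Data.Fin.Subset using (Subset; ⊤; ⊥)
open import Data.Integer.Base using (ℤ; -[1+_]; 0ℤ; 1ℤ; -1ℤ; ∣_∣)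
import Data.Integer.Properties as ℤ
open import Data.Integer.Tactic.RingSolver using (solve-∀)
open import Data.List.Base as List using (List; _++_; filter; allFin)
import Data.List.Extrema
open import Data.List.Membership.Propositional using (_∈_)
open import Data.List.Membership.Propositional.Properties
  using (∈-++⁺ˡ; ∈-++⁺ʳ; ∈-map⁺; ∈-filter⁺; ∈-allFin; ∈-cartesianProductWith⁺)
import Data.List.Relation.Unary.All as All
open import Data.List.Relation.Unary.All.Properties using (all-filter)
open import Data.List.Relation.Unary.Any using (here; there)
open import Data.Maybe.Base as Maybe using ()
open import Data.Nat.Base using (zero; suc)
import Data.Nat.Properties as ℕ
open import Data.Product.Base using (_,_; proj₁; proj₂)
open import Data.Sum.Base as Sum using (_⊎_; inj₁; inj₂)
open import Data.Vec.Base as Vec using (lookup; tabulate)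
open import Data.Vec.Functional using (insertAt; removeAt)
import Data.Vec.Functional.Properties as VecF
open import Data.Vec.Properties using (lookup∘tabulate; lookup-replicate)
open import Function.Base using (_∘_)
open import Function.Bundles using (mk⇔)
open import Function.Definitions using (Injective)
open import Level using (_⊔_)
open import Relation.Binary.Bundles using (TotalOrder; StrictPartialOrder)
import Relation.Binary.Construct.StrictToNonStrict as StrictToNonStrict
open import Relation.Binary.Definitions using (tri<; tri≈; tri>)
open import Relation.Binary.PropositionalEquality as ≡ using (_≡_; _≢_)
import Relation.Binary.Reasoning.Setoid
import Relation.Binary.Reasoning.StrictPartialOrder
open import Relation.Binary.Structures using (IsStrictTotalOrder)
open import Relation.Nullary.Decidable using (Dec; does; yes; no; _×-dec_; ¬?; dec⇒maybe; dec-false; does-⇔)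
open import Relation.Nullary.Negation.Core using (¬_)

-- An ordered field offers no compactness, so the optimum has to come out of a finite search. One
-- search serves all purposes because a basis determines `k` and every `q` by integer determinants
-- alone, whatever `t` is: a schedule enters with `t = v T` and total weight `T`, a packing with
-- `t = k` and its number of bins as total weight, and both are measured against the same ratio.
-- Bases call for equations, so overcoverage is absorbed by negative unit columns of price zero;
-- these account for the signs. Discarding them from a basic cover can only raise the coverage,
-- which is why the multiplicities of the remaining sets still give a packing. Cramer's rule is
-- itself read off a kernel vector: with a column of ones placed before the basis, the maximal
-- minors are the determinant of the basis and, up to sign, the Cramer numerators. The determinant
-- theory thus rests on the vanishing for two equal rows, and column replacement is avoided.

-- Signs, counting and finite sums of integers

module ℕΣ = Algebra.Properties.Semiring.Sum ℕ.+-*-semiring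
module ℤΣ = Algebra.Properties.Semiring.Sum ℤ.+-*-semiring
module ℤΠ = Algebra.Properties.CommutativeMonoid.Sum ℤ.*-1-commutativeMonoid

-- Here `u` is the sign of `d`. One unit serves `d` and every `x` of compatible sign, so an equation
-- linear in such determinants passes to absolute values on multiplication by `u`.
absUnit : ∀ {d} → d ≢ 0ℤ → ∃[ u ] + ∣ d ∣ ≡ u ℤ.* d × ∀ {x} → 0ℤ ℤ.≤ d ℤ.* x → + ∣ x ∣ ≡ u ℤ.* x
absUnit {+ zero}  d≢0 = ⊥-elim (d≢0 ≡.refl)
absUnit {+ suc d} _   = 1ℤ , ≡.sym (ℤ.*-identityˡ (+ suc d)) , same
  where
  same : ∀ {x} → 0ℤ ℤ.≤ + suc d ℤ.* x → + ∣ x ∣ ≡ 1ℤ ℤ.* x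
  same {+ n} _ = ≡.sym (ℤ.*-identityˡ (+ n))
absUnit { -[1+ d ]} _ = -1ℤ , ≡.sym (ℤ.-1*i≡-i -[1+ d ]) , opposite
  where
  opposite : ∀ {x} → 0ℤ ℤ.≤ -[1+ d ] ℤ.* x → + ∣ x ∣ ≡ -1ℤ ℤ.* x
  opposite {+ zero}   _ = ≡.refl
  opposite { -[1+ n ]} _ = ≡.sym (ℤ.-1*i≡-i -[1+ n ])

count : ∀ {m} → (Fin m → Bool) → ℕ
count P = ℕΣ.sum λ b → if P b then 1 else 0

pick : ∀ {m k} (P : Fin m → Bool) → k ℕ.≤ count P →
  ∃[ g ] Injective _≡_ _≡_ g × ∀ (j : Fin k) → P (g j) ≡ true
pick {k = zero} P _ = (λ ()) , (λ {}) , λ ()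
pick {suc m} {suc k} P le with P zero in eq
... | false with pick (P ∘ suc) le
...   | g , inj , hit = suc ∘ g , inj ∘ Fin.suc-injective , hit
pick {suc m} {suc k} P (ℕ.s≤s le) | true with pick (P ∘ suc) le
...   | g , inj , hit = g⁺ , inj⁺ , hit⁺
  where
  g⁺ : Fin (suc k) → Fin (suc m)
  g⁺ zero    = zero
  g⁺ (suc j) = suc (g j)
  inj⁺ : Injective _≡_ _≡_ g⁺
  inj⁺ {zero}  {zero}  e = ≡.refl
  inj⁺ {suc _} {suc _} e = ≡.cong suc (inj (Fin.suc-injective e))
  hit⁺ : ∀ j → P (g⁺ j) ≡ true
  hit⁺ zero    = eq
  hit⁺ (suc j) = hit j

sum-splitAt : ∀ m {n} (f : Fin m ⊎ Fin n → ℕ) →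
  ℕΣ.sum (f ∘ splitAt m) ≡ ℕΣ.sum (f ∘ inj₁) ℕ.+ ℕΣ.sum (f ∘ inj₂)
sum-splitAt zero    f = ≡.refl
sum-splitAt (suc m) f = ≡.trans (≡.cong (f (inj₁ zero) ℕ.+_) (sum-splitAt m (f ∘ Sum.map₁ suc)))
  (≡.sym (ℕ.+-assoc (f (inj₁ zero)) _ _))

-- Positions are laid out consecutively, `q r` of them for each `r`, and each is sent to its `r`.
-- This turns sets with multiplicities into a list of bins.
block : ∀ {n} (q : Fin n → ℕ) → Fin (ℕΣ.sum q) → Fin n
block {suc n} q b = Sum.[ (λ _ → zero) , suc ∘ block (q ∘ suc) ] (splitAt (q zero) b)

sum-block : ∀ {n} (q f : Fin n → ℕ) → ℕΣ.sum (f ∘ block q) ≡ ℕΣ.sum (λ r → q r ℕ.* f r)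
sum-block {zero}  q f = ≡.refl
sum-block {suc n} q f = ≡.trans (ℕΣ.sum-cong-≗ λ b → push (splitAt (q zero) b))
  (≡.trans (sum-splitAt (q zero) Sum.[ (λ _ → f zero) , f ∘ suc ∘ block (q ∘ suc) ])
    (≡.cong₂ ℕ._+_ (constant (q zero)) (sum-block (q ∘ suc) (f ∘ suc))))
  where
  push : ∀ s → f (Sum.[ (λ _ → zero) , suc ∘ block (q ∘ suc) ] s) ≡ Sum.[ (λ _ → f zero) , f ∘ suc ∘ block (q ∘ suc) ] s
  push (inj₁ _) = ≡.refl
  push (inj₂ _) = ≡.refl
  constant : ∀ m → ℕΣ.sum {m} (λ _ → f zero) ≡ m ℕ.* f zero
  constant zero    = ≡.refl
  constant (suc m) = ≡.cong (f zero ℕ.+_) (constant m)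

ℤsum-mono-≤ : ∀ {n} {f g : Fin n → ℤ} → (∀ i → f i ℤ.≤ g i) → ℤΣ.sum f ℤ.≤ ℤΣ.sum g
ℤsum-mono-≤ {zero}  le = ℤ.≤-refl
ℤsum-mono-≤ {suc n} le = ℤ.+-mono-≤ (le zero) (ℤsum-mono-≤ (le ∘ suc))

pos-sum : ∀ {n} (f : Fin n → ℕ) → + ℕΣ.sum f ≡ ℤΣ.sum (λ r → + f r)
pos-sum {zero}  f = ≡.refl
pos-sum {suc n} f = ≡.cong (λ z → + f zero ℤ.+ z) (pos-sum (f ∘ suc))

-- Determinants, kernel vectors of minors, and the largest 0/1 determinant

module Determinants where
  open ≡
  open import Data.List.Base using ([]; _∷_; cartesianProductWith)
  open import Data.Vec.Base using (Vec; []; _∷_)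

  sign : ∀ {n} → Fin n → ℤ
  sign j = -1ℤ ℤ.^ toℕ j

  minor : ∀ {m n} {A : Set} → (Fin (suc m) → Fin (suc n) → A) → Fin (suc n) → Fin m → Fin n → A
  minor M j r c = M (suc r) (punchIn j c)

  det-cong : ∀ {n} {M N : Matrix n} → (∀ i j → M i j ≡ N i j) → det M ≡ det N
  det-cong {zero}  e = refl
  det-cong {suc n} e = ℤΣ.sum-cong-≗ λ j →
    cong₂ ℤ._*_ (cong (sign j ℤ.*_) (e zero j)) (det-cong λ r c → e (suc r) (punchIn j c))

  -- (j , k) ↦ (punchIn j k , coPunch j k) exchanges the roles of the first and the second
  -- column deleted from a matrix.
  coPunch : ∀ {n} → Fin (suc (suc n)) → Fin (suc n) → Fin (suc n)
  coPunch zero    k       = zero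
  coPunch (suc j) zero    = j
  coPunch {suc n} (suc j) (suc k) = suc (coPunch j k)

  punchIn-coPunch : ∀ {n} (j : Fin (suc (suc n))) k (c : Fin n) →
    punchIn (punchIn j k) (punchIn (coPunch j k) c) ≡ punchIn j (punchIn k c)
  punchIn-coPunch zero    k       c = refl
  punchIn-coPunch (suc j) zero    c = refl
  punchIn-coPunch {suc n} (suc j) (suc k) zero = refl
  punchIn-coPunch {suc n} (suc j) (suc k) (suc c) = cong suc (punchIn-coPunch j k c)

  punchIn-punchIn : ∀ {n} (j : Fin (suc (suc n))) k → punchIn (punchIn j k) (coPunch j k) ≡ j
  punchIn-punchIn zero    k       = refl
  punchIn-punchIn (suc j) zero    = refl
  punchIn-punchIn {suc n} (suc j) (suc k) = cong suc (punchIn-punchIn j k)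

  -- Of two deleted columns, the right one has its index lowered by one exactly when it is deleted
  -- second, so exchanging the order changes the sum of the exponents by one.
  sign-coPunch : ∀ {n} (j : Fin (suc (suc n))) k →
    sign (punchIn j k) ℤ.* sign (coPunch j k) ≡ ℤ.- (sign j ℤ.* sign k)
  sign-coPunch zero    k       = lemma (sign k)
    where lemma : ∀ s → -1ℤ ℤ.* s ℤ.* 1ℤ ≡ ℤ.- (1ℤ ℤ.* s)
          lemma = solve-∀
  sign-coPunch (suc j) zero    = lemma (sign j)
    where lemma : ∀ s → 1ℤ ℤ.* s ≡ ℤ.- (-1ℤ ℤ.* s ℤ.* 1ℤ)
          lemma = solve-∀
  sign-coPunch {suc n} (suc j) (suc k) =
    trans (lemma (sign (punchIn j k)) (sign (coPunch j k)))
      (trans (sign-coPunch j k) (cong ℤ.-_ (sym (lemma (sign j) (sign k)))))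
    where lemma : ∀ s t → (-1ℤ ℤ.* s) ℤ.* (-1ℤ ℤ.* t) ≡ s ℤ.* t
          lemma = solve-∀

  -- The exchange permutes the ordered pairs of distinct columns: pairs beginning with column zero
  -- trade places with pairs ending in it, and the others are handled by induction.
  ∑∑-coPunch : ∀ {n} (h : Fin (suc (suc n)) → Fin (suc n) → ℤ) →
    ℤΣ.sum (λ j → ℤΣ.sum (h j)) ≡ ℤΣ.sum (λ j → ℤΣ.sum λ k → h (punchIn j k) (coPunch j k))
  ∑∑-coPunch {n} h = trans (cong₂ ℤ._+_ (refl {x = ℤΣ.sum (h zero)}) (split (h ∘ suc)))
    (trans (lemma (ℤΣ.sum (h zero)) (ℤΣ.sum (λ k → h (suc k) zero))
      (ℤΣ.sum λ j → ℤΣ.sum λ k → h (suc j) (suc k)))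
    (trans (cong₂ ℤ._+_ (refl {x = ℤΣ.sum (λ k → h (suc k) zero)})
              (cong₂ ℤ._+_ (refl {x = ℤΣ.sum (h zero)}) (inner n h)))
      (cong₂ ℤ._+_ (refl {x = ℤΣ.sum (λ k → h (suc k) zero)})
        (sym (split λ j k → h (punchIn (suc j) k) (coPunch (suc j) k))))))
    where
    split : ∀ {m n} (f : Fin m → Fin (suc n) → ℤ) → ℤΣ.sum (λ j → ℤΣ.sum (f j)) ≡
      ℤΣ.sum (λ j → f j zero) ℤ.+ ℤΣ.sum (λ j → ℤΣ.sum λ k → f j (suc k))
    split f = ℤΣ.∑-distrib-+ (λ j → f j zero) (λ j → ℤΣ.sum λ k → f j (suc k))
    lemma : ∀ a b c → a ℤ.+ (b ℤ.+ c) ≡ b ℤ.+ (a ℤ.+ c)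
    lemma = solve-∀
    inner : ∀ n (h : Fin (suc (suc n)) → Fin (suc n) → ℤ) →
      ℤΣ.sum (λ j → ℤΣ.sum λ k → h (suc j) (suc k)) ≡
      ℤΣ.sum (λ j → ℤΣ.sum λ k → h (punchIn (suc j) (suc k)) (coPunch (suc j) (suc k)))
    inner zero    h = refl
    inner (suc n) h = ∑∑-coPunch λ j k → h (suc j) (suc k)

  swap₀₁ : ∀ {n} {A : Set} → (Fin (suc (suc n)) → A) → Fin (suc (suc n)) → A
  swap₀₁ f zero          = f (suc zero)
  swap₀₁ f (suc zero)    = f zero
  swap₀₁ f (suc (suc r)) = f (suc (suc r))

  -- Expansion along two rows is a sum over ordered pairs of distinct columns. Exchanging the
  -- members of each pair keeps the remaining minor and reverses the sign.
  det-swap : ∀ {n} (M : Matrix (suc (suc n))) → det (swap₀₁ M) ≡ ℤ.- det M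
  det-swap {n} M = trans (expand (swap₀₁ M)) (trans (∑∑-coPunch (term (swap₀₁ M)))
    (trans (ℤΣ.sum-cong-≗ λ j → trans (ℤΣ.sum-cong-≗ (flipped j))
        (sym (ℤΣ.*-distribˡ-sum -1ℤ (term M j))))
      (trans (sym (ℤΣ.*-distribˡ-sum -1ℤ (λ j → ℤΣ.sum (term M j))))
      (trans (cong (-1ℤ ℤ.*_) (sym (expand M))) (ℤ.-1*i≡-i (det M))))))
    where
    rest : Matrix (suc (suc n)) → Fin (suc (suc n)) → Fin (suc n) → Matrix n
    rest M j k = minor (minor M j) k
    term : Matrix (suc (suc n)) → Fin (suc (suc n)) → Fin (suc n) → ℤ
    term M j k = (sign j ℤ.* sign k) ℤ.* (M zero j ℤ.* M (suc zero) (punchIn j k)) ℤ.* det (rest M j k)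
    lemma : ∀ s t a b d → s ℤ.* a ℤ.* (t ℤ.* b ℤ.* d) ≡ (s ℤ.* t) ℤ.* (a ℤ.* b) ℤ.* d
    lemma = solve-∀
    expand : ∀ M → det M ≡ ℤΣ.sum λ j → ℤΣ.sum (term M j)
    expand M = ℤΣ.sum-cong-≗ λ j →
      trans (ℤΣ.*-distribˡ-sum (sign j ℤ.* M zero j) (λ k → sign k ℤ.* M (suc zero) (punchIn j k) ℤ.* det (rest M j k)))
        (ℤΣ.sum-cong-≗ λ k → lemma (sign j) (sign k) (M zero j) (M (suc zero) (punchIn j k)) (det (rest M j k)))
    lemma′ : ∀ s a b d → ℤ.- s ℤ.* (a ℤ.* b) ℤ.* d ≡ -1ℤ ℤ.* (s ℤ.* (b ℤ.* a) ℤ.* d)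
    lemma′ = solve-∀
    flipped : ∀ j k → term (swap₀₁ M) (punchIn j k) (coPunch j k) ≡ -1ℤ ℤ.* term M j k
    flipped j k = trans
      (cong₂ ℤ._*_ (cong₂ ℤ._*_ (sign-coPunch j k)
         (cong (M (suc zero) (punchIn j k) ℤ.*_) (cong (M zero) (punchIn-punchIn j k))))
         (det-cong λ r c → cong (M (suc (suc r))) (punchIn-coPunch j k c)))
      (lemma′ (sign j ℤ.* sign k) (M (suc zero) (punchIn j k)) (M zero j) (det (rest M j k)))

  i≡-i⇒i≡0 : ∀ {i} → i ≡ ℤ.- i → i ≡ 0ℤ
  i≡-i⇒i≡0 {+ zero} e = refl

  det-equalRows : ∀ {n} (M : Matrix (suc n)) i → (∀ c → M zero c ≡ M (suc i) c) → det M ≡ 0ℤ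
  det-equalRows {suc n} M zero e = i≡-i⇒i≡0 (trans (det-cong same) (det-swap M))
    where
    same : ∀ r c → M r c ≡ swap₀₁ M r c
    same zero          c = e c
    same (suc zero)    c = sym (e c)
    same (suc (suc r)) c = refl
  -- After the swap the old row zero lies in every minor of the expansion, together with the row
  -- equal to it, so induction applies to each minor.
  det-equalRows {suc n} M (suc i) e =
    trans (trans (sym (ℤ.neg-involutive (det M))) (cong ℤ.-_ (sym (det-swap M)))) (cong ℤ.-_ swapped)
    where
    swapped : det (swap₀₁ M) ≡ 0ℤ
    swapped = trans (ℤΣ.sum-cong-≗ λ j →
        trans (cong (sign j ℤ.* swap₀₁ M zero j ℤ.*_)
                (det-equalRows (minor (swap₀₁ M) j) i λ c → e (punchIn j c)))
              (ℤ.*-zeroʳ (sign j ℤ.* swap₀₁ M zero j)))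
      (ℤΣ.sum-replicate-zero (suc (suc n)))

  -- The generalised cross product of the rows of `W`.
  cofactor : ∀ {n} → (Fin n → Fin (suc n) → ℤ) → Fin (suc n) → ℤ
  cofactor W j = sign j ℤ.* det (λ r c → W r (punchIn j c))

  -- Expands the (n + 1) × (n + 1) matrix obtained by repeating row i of W on top of W.
  cofactor-kernel : ∀ {n} (W : Fin n → Fin (suc n) → ℤ) i →
    ℤΣ.sum (λ j → W i j ℤ.* cofactor W j) ≡ 0ℤ
  cofactor-kernel {n} W i = trans
    (ℤΣ.sum-cong-≗ λ j → lemma (W i j) (sign j) (det λ r c → W r (punchIn j c))) (det-equalRows repeated i λ c → refl)
    where
    repeated : Matrix (suc n)
    repeated zero    = W i
    repeated (suc r) = W r
    lemma : ∀ w s d → w ℤ.* (s ℤ.* d) ≡ s ℤ.* w ℤ.* d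
    lemma = solve-∀

  det-scaleColumns : ∀ {n} (s : Fin n → ℤ) (M : Matrix n) →
    det (λ i j → s j ℤ.* M i j) ≡ ℤΠ.sum s ℤ.* det M
  det-scaleColumns {zero}  s M = refl
  det-scaleColumns {suc n} s M = trans (ℤΣ.sum-cong-≗ λ j →
      trans (cong (sign j ℤ.* (s j ℤ.* M zero j) ℤ.*_) (det-scaleColumns (s ∘ punchIn j) (minor M j)))
      (trans (lemma (sign j) (s j) (M zero j) (ℤΠ.sum (s ∘ punchIn j)) (det (minor M j)))
        (cong (ℤ._* (sign j ℤ.* M zero j ℤ.* det (minor M j))) (sym (ℤΠ.sum-remove {i = j} s)))))
    (sym (ℤΣ.*-distribˡ-sum (ℤΠ.sum s) λ j → sign j ℤ.* M zero j ℤ.* det (minor M j)))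
    where
    lemma : ∀ t s a p d → t ℤ.* (s ℤ.* a) ℤ.* (p ℤ.* d) ≡ s ℤ.* p ℤ.* (t ℤ.* a ℤ.* d)
    lemma = solve-∀

  -𝟙 : ∀ {n} → Matrix n
  -𝟙 i j = if does (j Fin.≟ i) then -1ℤ else 0ℤ

  ∣det-𝟙∣≡1 : ∀ n → ∣ det (-𝟙 {n}) ∣ ≡ 1
  ∣det-𝟙∣≡1 zero    = refl
  ∣det-𝟙∣≡1 (suc n) = trans (cong ∣_∣ expand) (trans (ℤ.∣-i∣≡∣i∣ (det (-𝟙 {n}))) (∣det-𝟙∣≡1 n))
    where
    expand : det (-𝟙 {suc n}) ≡ ℤ.- det (-𝟙 {n})
    expand = trans (cong₂ ℤ._+_ (ℤ.-1*i≡-i (det (-𝟙 {n})))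
      (trans (ℤΣ.sum-cong-≗ λ j → cong (ℤ._* det (minor (-𝟙 {suc n}) (suc j))) (ℤ.*-zeroʳ (sign (suc j))))
        (ℤΣ.sum-replicate-zero n))) (ℤ.+-identityʳ _)

  det-∣column∣ : ∀ {n} (M : Matrix n) → (∀ j → ∃[ s ] ∣ s ∣ ≡ 1 × ∀ i → ∃[ b ] (b ≡ 0ℤ ⊎ b ≡ 1ℤ) × M i j ≡ s ℤ.* b) →
    ∃[ N ] ZeroOne {n} N × ∣ det M ∣ ≡ ∣ det N ∣
  det-∣column∣ {n} M dec = N , (λ i j → proj₁ (proj₂ (proj₂ (proj₂ (dec j)) i))) ,
    trans (cong ∣_∣ (trans (det-cong λ i j → proj₂ (proj₂ (proj₂ (proj₂ (dec j)) i))) (det-scaleColumns s N)))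
      (trans (ℤ.abs-* (ℤΠ.sum s) (det N)) (trans (cong (ℕ._* ∣ det N ∣) (unit s λ j → proj₁ (proj₂ (dec j))))
        (ℕ.*-identityˡ _)))
    where
    s : Fin n → ℤ
    s j = proj₁ (dec j)
    N : Matrix n
    N i j = proj₁ (proj₂ (proj₂ (dec j)) i)
    unit : ∀ {n} (s : Fin n → ℤ) → (∀ j → ∣ s j ∣ ≡ 1) → ∣ ℤΠ.sum s ∣ ≡ 1
    unit {zero}  s e = refl
    unit {suc n} s e = trans (ℤ.abs-* (s zero) _) (cong₂ ℕ._*_ (e zero) (unit (s ∘ suc) (e ∘ suc)))

  module ℤ-Extrema = Data.List.Extrema ℤ.≤-totalOrder

  vectors : {A : Set} → List A → ∀ n → List (Vec A n)
  vectors xs zero    = [] ∷ []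
  vectors xs (suc n) = cartesianProductWith _∷_ xs (vectors xs n)

  ∈-vectors : {A : Set} {xs : List A} → (∀ x → x ∈ xs) → ∀ {n} (v : Vec A n) → v ∈ vectors xs n
  ∈-vectors all []      = here refl
  ∈-vectors all (x ∷ v) = ∈-cartesianProductWith⁺ _∷_ (all x) (∈-vectors all v)

  booleans : List Bool
  booleans = true ∷ false ∷ []

  ∈-booleans : ∀ b → b ∈ booleans
  ∈-booleans true  = here refl
  ∈-booleans false = there (here refl)

  indicator : Bool → ℤ
  indicator b = if b then 1ℤ else 0ℤ

  fromBits : ∀ {n} → Vec (Vec Bool n) n → Matrix n
  fromBits v i j = indicator (lookup (lookup v i) j)

  -- Matrices are functions, so the finite search for a maximum runs over bit vectors instead. It
  -- reaches a 0/1 matrix only up to pointwise equality, which `det-cong` bridges.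
  fromBits-surjective : ∀ {n} {M : Matrix n} → ZeroOne M → ∃[ v ] ∀ i j → M i j ≡ fromBits v i j
  fromBits-surjective {n} {M} zo = tabulate (λ i → tabulate λ j → bit (zo i j)) , λ i j →
    sym (trans (cong (λ u → indicator (lookup u j)) (lookup∘tabulate _ i))
      (trans (cong indicator (lookup∘tabulate _ j)) (indicator-bit (zo i j))))
    where
    bit : ∀ {z} → z ≡ 0ℤ ⊎ z ≡ 1ℤ → Bool
    bit (inj₁ _) = false
    bit (inj₂ _) = true
    indicator-bit : ∀ {z} (e : z ≡ 0ℤ ⊎ z ≡ 1ℤ) → indicator (bit e) ≡ z
    indicator-bit (inj₁ refl) = refl
    indicator-bit (inj₂ refl) = refl

  indicator-01 : ∀ b → indicator b ≡ 0ℤ ⊎ indicator b ≡ 1ℤ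
  indicator-01 true  = inj₂ refl
  indicator-01 false = inj₁ refl

  maxDet01 : ∀ n → ∃[ a ] IsMaxDet01 n a
  maxDet01 n = det (fromBits best) ,
    (fromBits best , (λ i j → indicator-01 _) , refl) , λ { _ (M , zo , refl) → maximal M zo }
    where
    candidates = vectors (vectors booleans n) n
    start = Vec.replicate n (Vec.replicate n false)
    best = ℤ-Extrema.argmax (det ∘ fromBits) start candidates
    maximal : ∀ M → ZeroOne M → det M ℤ.≤ det (fromBits best)
    maximal M zo with fromBits-surjective zo
    ... | v , e = subst (ℤ._≤ _) (sym (det-cong e))
      (All.lookup (ℤ-Extrema.f[xs]≤f[argmax] {f = det ∘ fromBits} start candidates)
        (∈-vectors (∈-vectors ∈-booleans) v))

  -- The maximum is over signed determinants. A negative one becomes positive when two rows are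
  -- swapped; a matrix with fewer than two rows and 0/1 entries has none.
  ∣det∣≤maxDet01 : ∀ {n a} → IsMaxDet01 n a → (M : Matrix n) → ZeroOne M → + ∣ det M ∣ ℤ.≤ a
  ∣det∣≤maxDet01 {n} {a} (_ , max) M zo with det M in eq
  ... | + _ = max _ (M , zo , eq)
  ... | -[1+ d ] = negative n M zo eq max
    where
    negative : ∀ n (M : Matrix n) → ZeroOne M → det M ≡ -[1+ d ] →
      (∀ x → (∃[ M ] ZeroOne {n} M × det M ≡ x) → x ℤ.≤ a) → + suc d ℤ.≤ a
    negative (suc zero) M zo eq max with M zero zero | zo zero zero | eq
    ... | _ | inj₁ refl | ()
    ... | _ | inj₂ refl | ()
    negative (suc (suc n)) M zo eq max =
      max _ (swap₀₁ M , swapped , trans (det-swap M) (cong ℤ.-_ eq))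
      where
      swapped : ZeroOne (swap₀₁ M)
      swapped zero          = zo (suc zero)
      swapped (suc zero)    = zo zero
      swapped (suc (suc r)) = zo (suc (suc r))

open Determinants

-- Arithmetic in an ordered field

module OverField {c ℓ₁ ℓ₂} (F : OrderedField c ℓ₁ ℓ₂) where
  open import Data.Vec.Functional using (_∷_)
  open OrderedField F
  open CommutativeRing commutativeRing public using
    ( ring; semiring; refl; sym; trans; reflexive; +-cong; +-congˡ; +-congʳ; *-congˡ; *-congʳ
    ; +-identityˡ; +-identityʳ; *-identityˡ; *-identityʳ; +-comm; *-comm; +-assoc; *-assoc
    ; -‿cong; -‿inverseˡ; -‿inverseʳ; zeroˡ; zeroʳ; distribˡ; setoid)
  open IsStrictTotalOrder isStrictTotalOrder public using
    (compare; isStrictPartialOrder; <-respˡ-≈; <-respʳ-≈; irrefl; asym)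
    renaming (trans to <-trans)
  open Algebra.Properties.Ring ring public using
    (-0#≈0#; -‿involutive; -‿distribˡ-*; -‿distribʳ-*; -‿anti-homo-+)
  module Mult = Algebra.Properties.Semiring.Mult semiring
  open Algebra.Properties.Semiring.Sum semiring public
    hiding (sum)

  strictPartialOrder : StrictPartialOrder c ℓ₁ ℓ₂
  strictPartialOrder = record { isStrictPartialOrder = isStrictPartialOrder }

  module ≤-Reasoning = Relation.Binary.Reasoning.StrictPartialOrder strictPartialOrder

  ≤-totalOrder : TotalOrder c ℓ₁ (ℓ₁ ⊔ ℓ₂)
  ≤-totalOrder = record { isTotalOrder = StrictToNonStrict.isTotalOrder _≈_ _<_ isStrictTotalOrder }

  open TotalOrder ≤-totalOrder public using (total)
    renaming (trans to ≤-trans; refl to ≤-refl; reflexive to ≤-reflexive; antisym to ≤-antisym)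

  -- Determinants stay in ℤ, where `k` and `q` must live; this homomorphism carries them into the
  -- field and also supplies the coefficients of the ring solver.
  ι : ℤ → Carrier
  ι (+ n)    = n · 1#
  ι -[1+ n ] = - (suc n · 1#)

  module _ where
    open import Relation.Binary.Reasoning.Setoid setoid

    [x+y]-[x+z]≈y-z : ∀ x y z → (x + y) - (x + z) ≈ y - z
    [x+y]-[x+z]≈y-z x y z = begin
      (x + y) - (x + z)      ≈⟨ +-congˡ (-‿anti-homo-+ x z) ⟩
      (x + y) + (- z - x)    ≈⟨ +-cong (+-comm x y) (+-comm (- z) (- x)) ⟩
      (y + x) + (- x - z)    ≈⟨ +-assoc y x _ ⟩
      y + (x + (- x - z))    ≈⟨ +-congˡ (sym (+-assoc x (- x) (- z))) ⟩
      y + ((x - x) - z)      ≈⟨ +-congˡ (+-congʳ (-‿inverseʳ x)) ⟩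
      y + (0# - z)           ≈⟨ +-congˡ (+-identityˡ (- z)) ⟩
      y - z                  ∎

    ι-⊖ : ∀ m n → ι (m ℤ.⊖ n) ≈ m · 1# - n · 1#
    ι-⊖ zero    zero    = sym (-‿inverseʳ 0#)
    ι-⊖ zero    (suc n) = sym (+-identityˡ _)
    ι-⊖ (suc m) zero    = sym (trans (+-congˡ -0#≈0#) (+-identityʳ _))
    ι-⊖ (suc m) (suc n) = begin
      ι (suc m ℤ.⊖ suc n)          ≡⟨ ≡.cong ι (ℤ.[1+m]⊖[1+n]≡m⊖n m n) ⟩
      ι (m ℤ.⊖ n)                  ≈⟨ ι-⊖ m n ⟩
      m · 1# - n · 1#              ≈⟨ [x+y]-[x+z]≈y-z 1# _ _ ⟨
      suc m · 1# - suc n · 1#      ∎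

    ι-+ : ∀ i j → ι (i ℤ.+ j) ≈ ι i + ι j
    ι-+ (+ m)    (+ n)    = Mult.×-homo-+ 1# m n
    ι-+ (+ m)    -[1+ n ] = ι-⊖ m (suc n)
    ι-+ -[1+ m ] (+ n)    = trans (ι-⊖ n (suc m)) (+-comm _ _)
    ι-+ -[1+ m ] -[1+ n ] = begin
      - (suc (suc (m ℕ.+ n)) · 1#)      ≡⟨ ≡.cong (λ k → - (suc k · 1#)) (≡.sym (ℕ.+-suc m n)) ⟩
      - ((suc m ℕ.+ suc n) · 1#)        ≈⟨ -‿cong (Mult.×-homo-+ 1# (suc m) (suc n)) ⟩
      - (suc m · 1# + suc n · 1#)       ≈⟨ -‿anti-homo-+ _ _ ⟩
      - (suc n · 1#) - suc m · 1#       ≈⟨ +-comm _ _ ⟩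
      - (suc m · 1#) - suc n · 1#       ∎

    ι-neg : ∀ i → ι (ℤ.- i) ≈ - ι i
    ι-neg (+ zero)  = sym -0#≈0#
    ι-neg (+ suc n) = refl
    ι-neg -[1+ n ]  = sym (-‿involutive _)

    ι-*⁺ : ∀ m j → ι (+ m ℤ.* j) ≈ ι (+ m) * ι j
    ι-*⁺ m (+ n)    = trans (reflexive (≡.cong ι (≡.sym (ℤ.pos-* m n)))) (Mult.×1-homo-* m n)
    ι-*⁺ m -[1+ n ] = begin
      ι (+ m ℤ.* -[1+ n ])            ≡⟨ ≡.cong ι (≡.sym (ℤ.neg-distribʳ-* (+ m) (+ suc n))) ⟩
      ι (ℤ.- (+ m ℤ.* + suc n))       ≈⟨ ι-neg (+ m ℤ.* + suc n) ⟩
      - ι (+ m ℤ.* + suc n)           ≈⟨ -‿cong (ι-*⁺ m (+ suc n)) ⟩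
      - (ι (+ m) * ι (+ suc n))       ≈⟨ -‿distribʳ-* _ _ ⟩
      ι (+ m) * ι -[1+ n ]            ∎

    ι-* : ∀ i j → ι (i ℤ.* j) ≈ ι i * ι j
    ι-* (+ m)    j = ι-*⁺ m j
    ι-* -[1+ m ] j = begin
      ι (-[1+ m ] ℤ.* j)              ≡⟨ ≡.cong ι (≡.sym (ℤ.neg-distribˡ-* (+ suc m) j)) ⟩
      ι (ℤ.- (+ suc m ℤ.* j))         ≈⟨ ι-neg (+ suc m ℤ.* j) ⟩
      - ι (+ suc m ℤ.* j)             ≈⟨ -‿cong (ι-*⁺ (suc m) j) ⟩
      - (ι (+ suc m) * ι j)           ≈⟨ -‿distribˡ-* _ _ ⟩
      ι -[1+ m ] * ι j                ∎

  ι-1 : ι 1ℤ ≈ 1#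
  ι-1 = +-identityʳ 1#

  almostCommutativeRing : ACR.AlmostCommutativeRing c ℓ₁
  almostCommutativeRing = ACR.fromCommutativeRing commutativeRing

  ι-morphism : ℤ.+-*-rawRing ACR.-Raw-AlmostCommutative⟶ almostCommutativeRing
  ι-morphism = record
    { ⟦_⟧    = ι
    ; +-homo = ι-+
    ; *-homo = ι-*
    ; -‿homo = ι-neg
    ; 0-homo = refl
    ; 1-homo = ι-1
    }

  module Solver = Algebra.Solver.Ring ℤ.+-*-rawRing almostCommutativeRing ι-morphism
    (λ i j → Maybe.map (reflexive ∘ ≡.cong ι) (dec⇒maybe (i ℤ.≟ j)))
  open Solver public using (solve; _:=_; _:+_; _:*_; :-_; _:-_; con)

  ι-sum : ∀ {n} (f : Fin n → ℤ) → ι (ℤΣ.sum f) ≈ sum (ι ∘ f)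
  ι-sum {zero}  f = refl
  ι-sum {suc n} f = trans (ι-+ (f zero) (ℤΣ.sum (f ∘ suc))) (+-congˡ (ι-sum (f ∘ suc)))

  +-mono-≤ : ∀ {x y u v} → x ≤ y → u ≤ v → x + u ≤ y + v
  +-mono-≤ {x} {y} {u} {v} x≤y u≤v = ≤-trans (right x u≤v)
    (≤-trans (≤-reflexive (+-comm x v)) (≤-trans (right v x≤y) (≤-reflexive (+-comm v y))))
    where
    right : ∀ x {u v} → u ≤ v → x + u ≤ x + v
    right x (inj₁ u<v) = inj₁ (+-monoʳ-< x u<v)
    right x (inj₂ u≈v) = inj₂ (+-congˡ u≈v)

  x≤y⇒0≤y-x : ∀ {x y} → x ≤ y → 0# ≤ y - x
  x≤y⇒0≤y-x {x} {y} x≤y = ≤-trans (≤-reflexive (sym (-‿inverseʳ x))) (+-mono-≤ x≤y ≤-refl)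

  0≤y-x⇒x≤y : ∀ {x y} → 0# ≤ y - x → x ≤ y
  0≤y-x⇒x≤y {x} {y} p = ≤-trans (≤-reflexive (sym (+-identityˡ x)))
    (≤-trans (+-mono-≤ p ≤-refl) (≤-reflexive (solve 2 (λ x y → y :- x :+ x := y) refl x y)))

  x<y⇒0<y-x : ∀ {x y} → x < y → 0# < y - x
  x<y⇒0<y-x {x} {y} x<y = <-respʳ-≈ (+-comm (- x) y) (<-respˡ-≈ (-‿inverseˡ x) (+-monoʳ-< (- x) x<y))

  0<y-x⇒x<y : ∀ {x y} → 0# < y - x → x < y
  0<y-x⇒x<y {x} {y} p = <-respʳ-≈ (solve 2 (λ x y → x :+ (y :- x) := y) refl x y)
    (<-respˡ-≈ (+-identityʳ x) (+-monoʳ-< x p))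

  x<0⇒0<-x : ∀ {x} → x < 0# → 0# < - x
  x<0⇒0<-x {x} x<0 = <-respʳ-≈ (+-identityˡ (- x)) (x<y⇒0<y-x x<0)

  x≤0⇒0≤-x : ∀ {x} → x ≤ 0# → 0# ≤ - x
  x≤0⇒0≤-x {x} x≤0 = ≤-trans (x≤y⇒0≤y-x x≤0) (≤-reflexive (+-identityˡ (- x)))

  0<x⇒-x<0 : ∀ {x} → 0# < x → - x < 0#
  0<x⇒-x<0 {x} 0<x = 0<y-x⇒x<y (<-respʳ-≈ (solve 1 (λ x → x := con 0ℤ :- (:- x)) refl x) 0<x)

  ≤⇒≯ : ∀ {x y} → x ≤ y → ¬ (y < x)
  ≤⇒≯ (inj₁ x<y) y<x = asym x<y y<x
  ≤⇒≯ (inj₂ x≈y) y<x = irrefl (sym x≈y) y<x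

  ≮⇒≥ : ∀ {x y} → ¬ (x < y) → y ≤ x
  ≮⇒≥ {x} {y} x≮y with compare x y
  ... | tri< x<y _ _ = ⊥-elim (x≮y x<y)
  ... | tri≈ _ x≈y _ = inj₂ (sym x≈y)
  ... | tri> _ _ y<x = inj₁ y<x

  *-nonneg : ∀ {x y} → 0# ≤ x → 0# ≤ y → 0# ≤ x * y
  *-nonneg (inj₁ 0<x) (inj₁ 0<y) = inj₁ (*-pos 0<x 0<y)
  *-nonneg {x} (inj₁ _) (inj₂ 0≈y) = inj₂ (trans (sym (zeroʳ x)) (*-congˡ 0≈y))
  *-nonneg {_} {y} (inj₂ 0≈x) _ = inj₂ (trans (sym (zeroˡ y)) (*-congʳ 0≈x))

  +-nonneg : ∀ {x y} → 0# ≤ x → 0# ≤ y → 0# ≤ x + y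
  +-nonneg p q = ≤-trans (≤-reflexive (sym (+-identityˡ 0#))) (+-mono-≤ p q)

  *-monoˡ-≤ : ∀ {z} → 0# ≤ z → ∀ {x y} → x ≤ y → z * x ≤ z * y
  *-monoˡ-≤ {z} 0≤z {x} {y} x≤y = 0≤y-x⇒x≤y (≤-trans (*-nonneg 0≤z (x≤y⇒0≤y-x x≤y))
    (≤-reflexive (solve 3 (λ x y z → z :* (y :- x) := z :* y :- z :* x) refl x y z)))

  *-monoˡ-< : ∀ {z} → 0# < z → ∀ {x y} → x < y → z * x < z * y
  *-monoˡ-< {z} 0<z {x} {y} x<y = 0<y-x⇒x<y (<-respʳ-≈
    (solve 3 (λ x y z → z :* (y :- x) := z :* y :- z :* x) refl x y z) (*-pos 0<z (x<y⇒0<y-x x<y)))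

  *-cancelˡ-≤ : ∀ {z} → 0# < z → ∀ {x y} → z * x ≤ z * y → x ≤ y
  *-cancelˡ-≤ 0<z zx≤zy = ≮⇒≥ λ y<x → ≤⇒≯ zx≤zy (*-monoˡ-< 0<z y<x)

  sum-mono-≤ : ∀ {n} {f g : Fin n → Carrier} → (∀ i → f i ≤ g i) → sum f ≤ sum g
  sum-mono-≤ {zero}  le = ≤-refl
  sum-mono-≤ {suc n} le = +-mono-≤ (le zero) (sum-mono-≤ (le ∘ suc))

  sum-nonneg : ∀ {n} {f : Fin n → Carrier} → (∀ i → 0# ≤ f i) → 0# ≤ sum f
  sum-nonneg {zero}  le = ≤-refl
  sum-nonneg {suc n} le = +-nonneg (le zero) (sum-nonneg (le ∘ suc))

  0≤n·1 : ∀ n → 0# ≤ n · 1#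
  0≤n·1 zero    = ≤-refl
  0≤n·1 (suc n) = +-nonneg (inj₁ 0<1) (0≤n·1 n)

  0<1+n·1 : ∀ n → 0# < suc n · 1#
  0<1+n·1 n with 0≤n·1 n
  ... | inj₁ 0<n = <-trans 0<1 (<-respˡ-≈ (+-identityʳ 1#) (+-monoʳ-< 1# 0<n))
  ... | inj₂ 0≈n = <-respʳ-≈ (trans (sym (+-identityʳ 1#)) (+-congˡ 0≈n)) 0<1

  ·1-cancel-≤ : ∀ m n → m · 1# ≤ n · 1# → m ℕ.≤ n
  ·1-cancel-≤ zero    n       p = ℕ.z≤n
  ·1-cancel-≤ (suc m) zero    p = ⊥-elim (≤⇒≯ p (0<1+n·1 m))
  ·1-cancel-≤ (suc m) (suc n) p = ℕ.s≤s (·1-cancel-≤ m n (0≤y-x⇒x≤y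
    (≤-trans (x≤y⇒0≤y-x p) (≤-reflexive ([x+y]-[x+z]≈y-z 1# (n · 1#) (m · 1#))))))

  0≤ι⇒0≤ : ∀ {i} → 0# ≤ ι i → 0ℤ ℤ.≤ i
  0≤ι⇒0≤ {+ n}      _ = ℤ.+≤+ ℕ.z≤n
  0≤ι⇒0≤ { -[1+ n ]} p = ⊥-elim (≤⇒≯ p (0<x⇒-x<0 (0<1+n·1 n)))

  -- An ordered field has characteristic zero.
  ι≈0⇒≡0 : ∀ i → ι i ≈ 0# → i ≡ 0ℤ
  ι≈0⇒≡0 (+ zero)  _ = ≡.refl
  ι≈0⇒≡0 (+ suc n) p = ⊥-elim (irrefl (sym p) (0<1+n·1 n))
  ι≈0⇒≡0 -[1+ n ]  p = ⊥-elim (irrefl p (0<x⇒-x<0 (0<1+n·1 n)))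

  0<⇒≉0 : ∀ {x} → 0# < x → ¬ (x ≈ 0#)
  0<⇒≉0 0<x x≈0 = irrefl (sym x≈0) 0<x

  x*y≈0⇒y≈0 : ∀ {x y} → ¬ (x ≈ 0#) → x * y ≈ 0# → y ≈ 0#
  x*y≈0⇒y≈0 {x} {y} x≉0 xy≈0 = begin
    y                 ≈⟨ *-identityˡ y ⟨
    1# * y            ≈⟨ *-congʳ (*-inverseʳ x x≉0) ⟨
    x * x ⁻¹ * y      ≈⟨ solve 3 (λ x i y → x :* i :* y := i :* (x :* y)) refl x (x ⁻¹) y ⟩
    x ⁻¹ * (x * y)    ≈⟨ *-congˡ xy≈0 ⟩
    x ⁻¹ * 0#         ≈⟨ zeroʳ (x ⁻¹) ⟩
    0#                ∎
    where open import Relation.Binary.Reasoning.Setoid setoid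

  0<x⁻¹ : ∀ {x} → 0# < x → 0# < x ⁻¹
  0<x⁻¹ {x} 0<x with compare 0# (x ⁻¹)
  ... | tri< p _ _ = p
  ... | tri≈ _ p _ = ⊥-elim (irrefl (trans (sym (zeroʳ x)) (trans (*-congˡ p) (*-inverseʳ x (0<⇒≉0 0<x)))) 0<1)
  ... | tri> _ _ p = ⊥-elim (asym 0<1 (<-respˡ-≈ (*-inverseʳ x (0<⇒≉0 0<x))
                        (<-respʳ-≈ (zeroʳ x) (*-monoˡ-< 0<x p))))

  y*x/y≈x : ∀ {x y} → 0# < y → y * (x / y) ≈ x
  y*x/y≈x {x} {y} 0<y = trans (solve 3 (λ x y i → y :* (x :* i) := y :* i :* x) refl x y (y ⁻¹))
    (trans (*-congʳ (*-inverseʳ y (0<⇒≉0 0<y))) (*-identityˡ x))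

  *-cancelˡ-≈ : ∀ {z} → 0# < z → ∀ {x y} → z * x ≈ z * y → x ≈ y
  *-cancelˡ-≈ 0<z e = ≤-antisym (*-cancelˡ-≤ 0<z (≤-reflexive e)) (*-cancelˡ-≤ 0<z (≤-reflexive (sym e)))

  module ≈-Reasoning = Relation.Binary.Reasoning.Setoid setoid

  sum-single : ∀ {n} (f : Fin n → Carrier) i → sum (λ j → if does (j Fin.≟ i) then f j else 0#) ≈ f i
  sum-single {suc n} f zero    = trans (+-congˡ (sum-replicate-zero n)) (+-identityʳ _)
  sum-single {suc n} f (suc i) = trans (+-identityˡ _) (sum-single (f ∘ suc) i)

  -- Basic solutions and pivoting

  infix 9 _⊙_

  _⊙_ : ∀ {n} → (Fin n → Carrier) → (Fin n → Carrier) → Carrier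
  f ⊙ a = sum λ j → f j * a j

  ⊙-congʳ : ∀ {n} (f : Fin n → Carrier) {a b} → (∀ j → a j ≈ b j) → f ⊙ a ≈ f ⊙ b
  ⊙-congʳ f e = sum-cong-≋ λ j → *-congˡ (e j)

  ⊙-+ : ∀ {n} (f a b : Fin n → Carrier) → f ⊙ (λ j → a j + b j) ≈ f ⊙ a + f ⊙ b
  ⊙-+ f a b = trans (sum-cong-≋ λ j → distribˡ (f j) (a j) (b j)) (∑-distrib-+ (λ j → f j * a j) (λ j → f j * b j))

  ⊙-* : ∀ {n} (f : Fin n → Carrier) θ a → f ⊙ (λ j → θ * a j) ≈ θ * f ⊙ a
  ⊙-* f θ a = trans (sum-cong-≋ λ j → solve 3 (λ f θ a → f :* (θ :* a) := θ :* (f :* a)) refl (f j) θ (a j))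
    (sym (*-distribˡ-sum θ λ j → f j * a j))

  ⊙-remove : ∀ {n} (f a : Fin (suc n) → Carrier) j → a j ≈ 0# → f ⊙ a ≈ removeAt f j ⊙ removeAt a j
  ⊙-remove f a j aj≈0 = trans (sum-remove {i = j} λ l → f l * a l)
    (trans (+-congʳ (trans (*-congˡ aj≈0) (zeroʳ (f j)))) (+-identityˡ _))

  -- The minimum-ratio rule of the simplex method, by recursion on coordinates. The step found for
  -- the tail is kept if the head stays nonnegative under it; otherwise the head blocks at a shorter
  -- step, which is safe for the tail too. The strict sign of `δ j` later licenses the removal of
  -- column `j`.
  ratioTest : ∀ {n} (z δ : Fin n → Carrier) → (∀ i → 0# ≤ z i) → (∀ i → 0# ≤ δ i) ⊎
    ∃[ θ ] ∃[ j ] 0# ≤ θ × δ j < 0# × (∀ i → 0# ≤ z i + θ * δ i) × z j + θ * δ j ≈ 0#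
  ratioTest {zero}  z δ z≥0 = inj₁ λ ()
  ratioTest {suc n} z δ z≥0 with ratioTest (z ∘ suc) (δ ∘ suc) (z≥0 ∘ suc) | compare (δ zero) 0#
  ... | inj₁ rest≥0 | tri≈ _ δ₀≈0 _ = inj₁ λ { zero → ≤-reflexive (sym δ₀≈0) ; (suc i) → rest≥0 i }
  ... | inj₁ rest≥0 | tri> _ _ δ₀>0 = inj₁ λ { zero → inj₁ δ₀>0 ; (suc i) → rest≥0 i }
  ... | inj₂ (θ , j , θ≥0 , δⱼ<0 , ok , tight) | tri≈ _ δ₀≈0 _ =
    inj₂ (θ , suc j , θ≥0 , δⱼ<0 ,
      (λ { zero → +-nonneg (z≥0 zero) (*-nonneg θ≥0 (≤-reflexive (sym δ₀≈0))) ; (suc i) → ok i }) , tight)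
  ... | inj₂ (θ , j , θ≥0 , δⱼ<0 , ok , tight) | tri> _ _ δ₀>0 =
    inj₂ (θ , suc j , θ≥0 , δⱼ<0 ,
      (λ { zero → +-nonneg (z≥0 zero) (*-nonneg θ≥0 (inj₁ δ₀>0)) ; (suc i) → ok i }) , tight)
  ... | rest | tri< δ₀<0 _ _ = step rest
    where
    θ₀ = z zero / - δ zero
    -δ₀>0 : 0# < - δ zero
    -δ₀>0 = x<0⇒0<-x δ₀<0
    θ₀≥0 : 0# ≤ θ₀
    θ₀≥0 = *-nonneg (z≥0 zero) (inj₁ (0<x⁻¹ -δ₀>0))
    tight₀ : z zero + θ₀ * δ zero ≈ 0#
    tight₀ = trans (solve 3 (λ z θ δ → z :+ θ :* δ := z :- (:- δ) :* θ) refl (z zero) θ₀ (δ zero))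
      (trans (+-congˡ (-‿cong (y*x/y≈x -δ₀>0))) (-‿inverseʳ (z zero)))
    step : _ → _
    step (inj₁ rest≥0) = inj₂ (θ₀ , zero , θ₀≥0 , δ₀<0 ,
      (λ { zero → ≤-reflexive (sym tight₀) ; (suc i) → +-nonneg (z≥0 (suc i)) (*-nonneg θ₀≥0 (rest≥0 i)) }) , tight₀)
    step (inj₂ (θ , j , θ≥0 , δⱼ<0 , ok , tight)) with compare (z zero + θ * δ zero) 0#
    ... | tri≈ _ e _ = inj₂ (θ , suc j , θ≥0 , δⱼ<0 ,
      (λ { zero → ≤-reflexive (sym e) ; (suc i) → ok i }) , tight)
    ... | tri> _ _ p = inj₂ (θ , suc j , θ≥0 , δⱼ<0 , (λ { zero → inj₁ p ; (suc i) → ok i }) , tight)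
    ... | tri< p _ _ = inj₂ (θ₀ , zero , θ₀≥0 , δ₀<0 ,
      (λ { zero → ≤-reflexive (sym tight₀) ; (suc i) → ok₀ i }) , tight₀)
      where
      θ₀≤θ : θ₀ ≤ θ
      θ₀≤θ = *-cancelˡ-≤ -δ₀>0 (≤-trans (≤-reflexive (y*x/y≈x -δ₀>0))
        (0≤y-x⇒x≤y (≤-trans (x≤0⇒0≤-x (inj₁ p)) (≤-reflexive
          (solve 3 (λ z θ δ → :- (z :+ θ :* δ) := :- δ :* θ :- z) refl (z zero) θ (δ zero))))))
      ok₀ : ∀ i → 0# ≤ z (suc i) + θ₀ * δ (suc i)
      ok₀ i with total 0# (δ (suc i))
      ... | inj₁ δᵢ≥0 = +-nonneg (z≥0 (suc i)) (*-nonneg θ₀≥0 δᵢ≥0)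
      ... | inj₂ δᵢ≤0 = ≤-trans (ok i) (+-mono-≤ ≤-refl (0≤y-x⇒x≤y (≤-trans
        (*-nonneg (x≤y⇒0≤y-x θ₀≤θ) (x≤0⇒0≤-x δᵢ≤0)) (≤-reflexive
          (solve 3 (λ s t d → (t :- s) :* (:- d) := s :* d :- t :* d) refl θ₀ θ (δ (suc i)))))))

  module Simplex {n : ℕ} {Column : Set} (entry : Column → Fin n → ℤ)
    (price : Column → Carrier) (price≥0 : ∀ v → 0# ≤ price v) {p} (Valid : Column → Set p) where

    row : ∀ {m} → (Fin m → Column) → Fin n → Fin m → Carrier
    row W i j = ι (entry (W j) i)

    matrix : ∀ {m} → (Fin m → Column) → Fin n → Fin m → ℤ
    matrix W i j = entry (W j) i

    InKernel : ∀ {m} → (Fin m → Column) → (Fin m → Carrier) → Set _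
    InKernel W a = ∀ i → row W i ⊙ a ≈ 0#

    Independent : ∀ {m} → (Fin m → Column) → Set _
    Independent W = ∀ a → InKernel W a → ∀ j → a j ≈ 0#

    -- Nonsingularity is recorded twice: the integer determinant makes the kernel vector of minors
    -- nonzero and is the denominator in Cramer's rule, while independence over the field makes the
    -- kernel a line. A pivot preserves each by its own argument, so neither is derived from the
    -- other.
    record BasicSolution (b : Fin n → Carrier) (C : Carrier) : Set (c ⊔ ℓ₁ ⊔ ℓ₂ ⊔ p) where
      field
        columns     : Fin n → Column
        valid       : ∀ j → Valid (columns j)
        det≢0       : det (matrix columns) ≢ 0ℤ
        independent : Independent columns
        weight      : Fin n → Carrier
        weight≥0    : ∀ j → 0# ≤ weight j
        solves      : ∀ i → row columns i ⊙ weight ≈ b i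
        cheap       : (price ∘ columns) ⊙ weight ≤ C

    open BasicSolution

    castBasic : ∀ {b b′ C C′} → (∀ i → b i ≈ b′ i) → C ≤ C′ → BasicSolution b C → BasicSolution b′ C′
    castBasic b≈b′ C≤C′ σ = record
      { columns = columns σ ; valid = valid σ ; det≢0 = det≢0 σ ; independent = independent σ
      ; weight = weight σ ; weight≥0 = weight≥0 σ
      ; solves = λ i → trans (solves σ i) (b≈b′ i)
      ; cheap = ≤-trans (cheap σ) C≤C′ }

    -- The combination `δ₀ a - a₀ δ` lies in the kernel and vanishes at `zero`, so independence of
    -- the other columns makes it vanish everywhere.
    kernel-line : ∀ {W : Fin (suc n) → Column} {a δ} → Independent (W ∘ suc) →
      InKernel W a → InKernel W δ → ∀ j → δ zero * a j ≈ a zero * δ j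
    kernel-line {W} {a} {δ} ind ka kδ zero = *-comm _ _
    kernel-line {W} {a} {δ} ind ka kδ (suc j) = begin
      δ₀ * a (suc j)                                              ≈⟨ solve 4 (λ x y s t → x :* y := (x :* y :+ :- s :* t) :+ s :* t) refl _ _ (a zero) (δ (suc j)) ⟩
      (δ₀ * a (suc j) + - a zero * δ (suc j)) + a zero * δ (suc j) ≈⟨ +-congʳ (ind (u ∘ suc) kernel j) ⟩
      0# + a zero * δ (suc j)                                     ≈⟨ +-identityˡ _ ⟩
      a zero * δ (suc j)                                          ∎
      where
      open ≈-Reasoning
      δ₀ = δ zero
      u : Fin (suc n) → Carrier
      u j = δ₀ * a j + - a zero * δ j
      u₀≈0 : u zero ≈ 0#
      u₀≈0 = solve 2 (λ x y → x :* y :+ :- y :* x := con 0ℤ) refl δ₀ (a zero)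
      kernel : ∀ i → row (W ∘ suc) i ⊙ (u ∘ suc) ≈ 0#
      kernel i = begin
        row (W ∘ suc) i ⊙ (u ∘ suc)                            ≈⟨ ⊙-remove (row W i) u zero u₀≈0 ⟨
        row W i ⊙ u                                            ≈⟨ ⊙-+ (row W i) (λ j → δ₀ * a j) (λ j → - a zero * δ j) ⟩
        row W i ⊙ (λ j → δ₀ * a j) + row W i ⊙ (λ j → - a zero * δ j)
          ≈⟨ +-cong (⊙-* (row W i) δ₀ a) (⊙-* (row W i) (- a zero) δ) ⟩
        δ₀ * row W i ⊙ a + - a zero * row W i ⊙ δ              ≈⟨ +-cong (*-congˡ (ka i)) (*-congˡ (kδ i)) ⟩
        δ₀ * 0# + - a zero * 0#                                ≈⟨ +-cong (zeroʳ _) (zeroʳ _) ⟩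
        0# + 0#                                                ≈⟨ +-identityˡ 0# ⟩
        0#                                                     ∎

    -- A relation among the remaining columns, padded with zero at `j`, is proportional to `δ`. As
    -- `δ` does not vanish at `j`, the relation is trivial.
    independent-remove : ∀ {W : Fin (suc n) → Column} {δ} → Independent (W ∘ suc) → InKernel W δ →
      ¬ (δ zero ≈ 0#) → ∀ j → ¬ (δ j ≈ 0#) → Independent (W ∘ punchIn j)
    independent-remove {W} {δ} ind kδ δ₀≉0 j δⱼ≉0 a ka l =
      trans (reflexive (≡.sym (VecF.insertAt-punchIn a j 0# l))) (x*y≈0⇒y≈0 δ₀≉0
        (trans (line (punchIn j l)) (trans (*-congʳ a₀≈0) (zeroˡ _))))
      where
      a⁺ = insertAt a j 0#
      a⁺ⱼ≈0 : a⁺ j ≈ 0#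
      a⁺ⱼ≈0 = reflexive (VecF.insertAt-lookup a j 0#)
      ka⁺ : InKernel W a⁺
      ka⁺ i = trans (⊙-remove (row W i) a⁺ j a⁺ⱼ≈0)
        (trans (⊙-congʳ (row (W ∘ punchIn j) i) λ l → reflexive (VecF.insertAt-punchIn a j 0# l)) (ka i))
      line : ∀ l → δ zero * a⁺ l ≈ a⁺ zero * δ l
      line = kernel-line {W} {a⁺} {δ} ind ka⁺ kδ
      a₀≈0 : a⁺ zero ≈ 0#
      a₀≈0 = x*y≈0⇒y≈0 δⱼ≉0 (trans (*-comm _ _) (trans (sym (line j)) (trans (*-congˡ a⁺ⱼ≈0) (zeroʳ _))))

    ι-kernel : ∀ {m} (W : Fin m → Column) k → (∀ i → ℤΣ.sum (λ j → matrix W i j ℤ.* k j) ≡ 0ℤ) →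
      InKernel W (ι ∘ k)
    ι-kernel W k e i = trans (sum-cong-≋ λ j → sym (ι-* (matrix W i j) (k j)))
      (trans (sym (ι-sum λ j → matrix W i j ℤ.* k j)) (reflexive (≡.cong ι (e i))))

    -- An improving direction in the kernel of W, chosen so that moving along it must eventually
    -- make some weight vanish.
    direction : ∀ (W : Fin (suc n) → Column) → det (matrix (W ∘ suc)) ≢ 0ℤ → ∃[ δ ]
      InKernel W δ × (∀ j → ¬ (δ j ≈ 0#) → det (matrix (W ∘ punchIn j)) ≢ 0ℤ) ×
      ¬ (δ zero ≈ 0#) × (price ∘ W) ⊙ δ ≤ 0# × ¬ (∀ j → 0# ≤ δ j)
    direction W det≢0 = choose
      where
      e = cofactor (matrix W)
      δ⁺ δ⁻ : Fin (suc n) → Carrier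
      δ⁺ = ι ∘ e
      δ⁻ j = - 1# * δ⁺ j
      ker⁺ : InKernel W δ⁺
      ker⁺ = ι-kernel W e (cofactor-kernel (matrix W))
      ker⁻ : InKernel W δ⁻
      ker⁻ i = trans (⊙-* (row W i) (- 1#) δ⁺) (trans (*-congˡ (ker⁺ i)) (zeroʳ _))
      supp⁺ : ∀ j → ¬ (δ⁺ j ≈ 0#) → det (matrix (W ∘ punchIn j)) ≢ 0ℤ
      supp⁺ j δ≉0 d≡0 = δ≉0 (reflexive (≡.cong ι (≡.trans (≡.cong (sign j ℤ.*_) d≡0) (ℤ.*-zeroʳ (sign j)))))
      supp⁻ : ∀ j → ¬ (δ⁻ j ≈ 0#) → det (matrix (W ∘ punchIn j)) ≢ 0ℤ
      supp⁻ j δ≉0 = supp⁺ j λ δ≈0 → δ≉0 (trans (*-congˡ δ≈0) (zeroʳ _))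
      δ⁺₀≉0 : ¬ (δ⁺ zero ≈ 0#)
      δ⁺₀≉0 δ≈0 = det≢0 (≡.trans (≡.sym (ℤ.*-identityˡ _)) (ι≈0⇒≡0 (e zero) δ≈0))
      -δ : ∀ x → - 1# * x ≈ - x
      -δ x = trans (sym (-‿distribˡ-* 1# x)) (-‿cong (*-identityˡ x))
      δ⁻₀≉0 : ¬ (δ⁻ zero ≈ 0#)
      δ⁻₀≉0 δ≈0 = δ⁺₀≉0 (trans (sym (-‿involutive _)) (trans (-‿cong (trans (sym (-δ _)) δ≈0)) -0#≈0#))
      cost⁻ : (price ∘ W) ⊙ δ⁻ ≈ - (price ∘ W) ⊙ δ⁺
      cost⁻ = trans (⊙-* (price ∘ W) (- 1#) δ⁺) (-δ _)
      cost≥0 : ∀ {δ} → (∀ j → 0# ≤ δ j) → 0# ≤ (price ∘ W) ⊙ δ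
      cost≥0 δ≥0 = sum-nonneg λ j → *-nonneg (price≥0 (W j)) (δ≥0 j)
      choose : _
      -- A direction of negative cost has a negative entry because no price is negative. At cost
      -- zero the sign is chosen so that the entry at `zero`, the entering column, is negative.
      choose with compare ((price ∘ W) ⊙ δ⁺) 0#
      ... | tri< neg _ _ = δ⁺ , ker⁺ , supp⁺ , δ⁺₀≉0 , inj₁ neg , λ δ≥0 → ≤⇒≯ (cost≥0 δ≥0) neg
      ... | tri> _ _ pos = δ⁻ , ker⁻ , supp⁻ , δ⁻₀≉0 , inj₁ neg , λ δ≥0 → ≤⇒≯ (cost≥0 δ≥0) neg
        where neg = <-respˡ-≈ (sym cost⁻) (0<x⇒-x<0 pos)
      ... | tri≈ _ nil _ with compare (δ⁺ zero) 0#
      ...   | tri< neg _ _ = δ⁺ , ker⁺ , supp⁺ , δ⁺₀≉0 , inj₂ nil , λ δ≥0 → ≤⇒≯ (δ≥0 zero) neg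
      ...   | tri≈ _ δ≈0 _ = ⊥-elim (δ⁺₀≉0 δ≈0)
      ...   | tri> _ _ pos = δ⁻ , ker⁻ , supp⁻ , δ⁻₀≉0 ,
        inj₂ (trans cost⁻ (trans (-‿cong nil) -0#≈0#)) ,
        λ δ≥0 → ≤⇒≯ (δ≥0 zero) (<-respˡ-≈ (sym (-δ _)) (0<x⇒-x<0 pos))

    -- Unlike in an ordinary simplex step, the right-hand side and the budget grow along with the
    -- new column, so `x` and the old weights solve the enlarged system at once and no separate
    -- search for feasibility arises. The column that leaves may be `v` itself.
    pivot : ∀ {b C} → BasicSolution b C → ∀ v → Valid v → ∀ {x} → 0# ≤ x →
      BasicSolution (λ i → ι (entry v i) * x + b i) (price v * x + C)
    pivot {b} {C} σ v valid-v {x} x≥0 with direction (v ∷ columns σ) (det≢0 σ)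
    ... | δ , ker , supp , δ₀≉0 , cost≤0 , ¬δ≥0 with ratioTest (x ∷ weight σ) δ (λ { zero → x≥0 ; (suc j) → weight≥0 σ j })
    ...   | inj₁ δ≥0 = ⊥-elim (¬δ≥0 δ≥0)
    ...   | inj₂ (θ , j , θ≥0 , δⱼ<0 , z′≥0 , z′ⱼ≈0) = record
      { columns     = W ∘ punchIn j
      ; valid       = λ l → valid-W (punchIn j l)
      ; det≢0       = supp j δⱼ≉0
      ; independent = independent-remove {W} {δ} (independent σ) ker δ₀≉0 j δⱼ≉0
      ; weight      = z′ ∘ punchIn j
      ; weight≥0    = λ l → z′≥0 (punchIn j l)
      ; solves      = λ i → begin-equality
          row (W ∘ punchIn j) i ⊙ (z′ ∘ punchIn j)   ≈⟨ ⊙-remove (row W i) z′ j z′ⱼ≈0 ⟨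
          row W i ⊙ z′                               ≈⟨ moved (row W i) ⟩
          row W i ⊙ z + θ * row W i ⊙ δ              ≈⟨ +-congˡ (trans (*-congˡ (ker i)) (zeroʳ θ)) ⟩
          row W i ⊙ z + 0#                           ≈⟨ +-identityʳ _ ⟩
          row W i ⊙ z                                ≈⟨ +-congˡ (solves σ i) ⟩
          ι (entry v i) * x + b i                    ∎
      ; cheap       = begin
          (price ∘ W ∘ punchIn j) ⊙ (z′ ∘ punchIn j) ≈⟨ ⊙-remove (price ∘ W) z′ j z′ⱼ≈0 ⟨
          (price ∘ W) ⊙ z′                           ≈⟨ moved (price ∘ W) ⟩
          (price ∘ W) ⊙ z + θ * (price ∘ W) ⊙ δ      ≤⟨ +-mono-≤ ≤-refl (*-monoˡ-≤ θ≥0 cost≤0) ⟩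
          (price ∘ W) ⊙ z + θ * 0#                   ≈⟨ trans (+-congˡ (zeroʳ θ)) (+-identityʳ _) ⟩
          (price ∘ W) ⊙ z                            ≤⟨ +-mono-≤ ≤-refl (cheap σ) ⟩
          price v * x + C                            ∎
      }
      where
      open ≤-Reasoning
      W = v ∷ columns σ
      z = x ∷ weight σ
      z′ : Fin (suc n) → Carrier
      z′ i = z i + θ * δ i
      δⱼ≉0 : ¬ (δ j ≈ 0#)
      δⱼ≉0 e = irrefl e δⱼ<0
      valid-W : ∀ j → Valid (W j)
      valid-W zero    = valid-v
      valid-W (suc j) = valid σ j
      moved : ∀ f → f ⊙ z′ ≈ f ⊙ z + θ * f ⊙ δ
      moved f = trans (⊙-+ f z λ j → θ * δ j) (+-congˡ (⊙-* f θ δ))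

    pivots : ∀ {b C} → BasicSolution b C → ∀ {m} (V : Fin m → Column) → (∀ l → Valid (V l)) →
      (x : Fin m → Carrier) → (∀ l → 0# ≤ x l) →
      BasicSolution (λ i → row V i ⊙ x + b i) ((price ∘ V) ⊙ x + C)
    pivots σ {zero}  V valid-V x x≥0 =
      castBasic (λ i → sym (+-identityˡ _)) (≤-reflexive (sym (+-identityˡ _))) σ
    pivots σ {suc m} V valid-V x x≥0 =
      castBasic (λ i → sym (+-assoc _ _ _)) (≤-reflexive (sym (+-assoc _ _ _)))
        (pivot (pivots σ (V ∘ suc) (valid-V ∘ suc) (x ∘ suc) (x≥0 ∘ suc)) (V zero) (valid-V zero) (x≥0 zero))

  -- The covering program and its best basis

  module Extrema = Data.List.Extrema ≤-totalOrder

  _≤?_ : ∀ x y → Dec (x ≤ y)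
  _≤?_ = StrictToNonStrict.decidable′ _≈_ _<_ compare

  ι-sum-ℕ : ∀ {n} (f : Fin n → ℕ) → ℕΣ.sum f · 1# ≈ sum (λ i → f i · 1#)
  ι-sum-ℕ {zero}  f = refl
  ι-sum-ℕ {suc n} f = trans (Mult.×-homo-+ 1# (f zero) (ℕΣ.sum (f ∘ suc))) (+-congˡ (ι-sum-ℕ (f ∘ suc)))

  module Columns {n : ℕ} (S : Carrier) (D : Fin n → Carrier) (T : Carrier) (0<S : 0# < S) where
    open ElectricityDivision F S D T

    -- The linear program minimises the total weight of the sets covering every household exactly,
    -- where inj₂ i is the slack column − eᵢ that absorbs overcoverage of household i.
    Column : Set
    Column = Subset n ⊎ Fin n

    entry : Column → Fin n → ℤ
    entry (inj₁ A) i = indicator (lookup A i)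
    entry (inj₂ l) i = -𝟙 i l

    units : Column → ℕ
    units (inj₁ _) = 1
    units (inj₂ _) = 0

    -- The empty set for slack columns lets one validity condition cover all columns; their
    -- multiplicity is zero, so they never become bins.
    households : Column → Subset n
    households (inj₁ A) = A
    households (inj₂ _) = ⊥

    Valid : Column → Set _
    Valid v = load (households v) ≤ S

    open Simplex entry (λ v → units v · 1#) (λ v → 0≤n·1 (units v)) Valid public

    allColumns : List Column
    allColumns = List.map inj₁ (vectors booleans n) ++ List.map inj₂ (allFin n)

    ∈-allColumns : ∀ v → v ∈ allColumns
    ∈-allColumns (inj₁ A) = ∈-++⁺ˡ (∈-map⁺ inj₁ (∈-vectors ∈-booleans A))
    ∈-allColumns (inj₂ i) = ∈-++⁺ʳ (List.map inj₁ (vectors booleans n)) (∈-map⁺ inj₂ (∈-allFin i))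

    valid-slack : ∀ i → Valid (inj₂ i)
    valid-slack _ = ≤-trans (≤-reflexive (trans
      (sum-cong-≋ λ i → reflexive (≡.cong (if_then D i else 0#) (lookup-replicate i false)))
      (sum-replicate-zero n))) (inj₁ 0<S)

    slack-row : ∀ i a → row inj₂ i ⊙ a ≈ - a i
    slack-row i a = trans (sum-cong-≋ λ j → case (does (j Fin.≟ i)) (a j))
      (sum-single (λ j → - a j) i)
      where
      case : ∀ b x → ι (if b then -1ℤ else 0ℤ) * x ≈ (if b then - x else 0#)
      case true  x = trans (sym (-‿distribˡ-* _ x)) (-‿cong (trans (*-congʳ ι-1) (*-identityˡ x)))
      case false x = zeroˡ x

    slackBasis : (s : Fin n → Carrier) → (∀ i → 0# ≤ s i) → BasicSolution (λ i → - s i) 0#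
    slackBasis s s≥0 = record
      { columns     = inj₂
      ; valid       = valid-slack
      ; det≢0       = λ det≡0 → ℕ.0≢1+n (≡.trans (≡.cong ∣_∣ (≡.sym det≡0)) (∣det-𝟙∣≡1 n))
      ; independent = λ a ka j → trans (sym (-‿involutive (a j)))
          (trans (-‿cong (trans (sym (slack-row j a)) (ka j))) -0#≈0#)
      ; weight      = s
      ; weight≥0    = s≥0
      ; solves      = λ i → slack-row i s
      ; cheap       = ≤-reflexive (trans (sum-cong-≋ λ j → zeroˡ (s j)) (sum-replicate-zero n))
      }

    coverage : ∀ {m} → (Fin m → Subset n) → (Fin m → Carrier) → Fin n → Carrier
    coverage sets x i = sum λ l → if lookup (sets l) i then x l else 0#

    -- Let `s` be the surplus of the coverage over `t`. The slack basis solves the system with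
    -- right-hand side `- s` at no cost, and pivoting in all the sets raises this to exactly `t`.
    coverBasis : ∀ {m t} (sets : Fin m → Subset n) → (∀ l → load (sets l) ≤ S) →
      (x : Fin m → Carrier) → (∀ l → 0# ≤ x l) → (∀ i → t ≤ coverage sets x i) →
      BasicSolution (λ _ → t) (sum x)
    coverBasis {m} {t} sets feasible x x≥0 covers =
      castBasic solved paid (pivots (slackBasis s λ i → x≤y⇒0≤y-x (covers i)) (inj₁ ∘ sets) feasible x x≥0)
      where
      s : Fin n → Carrier
      s i = coverage sets x i - t
      case : ∀ b x → ι (indicator b) * x ≈ (if b then x else 0#)
      case true  x = trans (*-congʳ ι-1) (*-identityˡ x)
      case false x = zeroˡ x
      solved : ∀ i → row (inj₁ ∘ sets) i ⊙ x - s i ≈ t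
      solved i = trans (+-congʳ (sum-cong-≋ λ l → case (lookup (sets l) i) (x l)))
        (solve 2 (λ u t → u :- (u :- t) := t) refl (coverage sets x i) t)
      paid : (λ l → units (inj₁ (sets l)) · 1#) ⊙ x + 0# ≤ sum x
      paid = ≤-reflexive (trans (+-identityʳ _) (sum-cong-≋ λ l → case true (x l)))

    -- The full set stands for the right-hand side of ones, merely as a vector; it need not be
    -- feasible.
    withTarget : (Fin n → Column) → Fin (suc n) → Column
    withTarget W = inj₁ ⊤ ∷ W

    denominator : (Fin n → Column) → ℤ
    denominator W = det (matrix W)

    -- This is Cramer's determinant of `W` with column `r` replaced by ones: the sign of the
    -- cofactor makes up for the ones standing in front.
    numerator : (Fin n → Column) → Fin n → ℤ
    numerator W r = ℤ.- cofactor (matrix (withTarget W)) (suc r)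

    target-entry : ∀ i → entry (inj₁ ⊤) i ≡ 1ℤ
    target-entry i = ≡.cong indicator (lookup-replicate i true)

    -- Row `i` of the kernel equation for the ones column followed by `W`, solved for the term of
    -- the ones column.
    cramer : ∀ W i → ℤΣ.sum (λ r → matrix W i r ℤ.* numerator W r) ≡ denominator W
    cramer W i = ≡.trans (ℤΣ.sum-cong-≗ λ r → negate (matrix W i r) (cof (suc r)))
      (≡.trans (≡.sym (ℤΣ.*-distribˡ-sum -1ℤ λ r → matrix W i r ℤ.* cof (suc r)))
        (solved (entry (inj₁ ⊤) i) (denominator W) (ℤΣ.sum λ r → matrix W i r ℤ.* cof (suc r))
          (target-entry i) (cofactor-kernel (matrix (withTarget W)) i)))
      where
      cof = cofactor (matrix (withTarget W))
      negate : ∀ a b → a ℤ.* ℤ.- b ≡ -1ℤ ℤ.* (a ℤ.* b)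
      negate = solve-∀
      rearrange : ∀ d s → 1ℤ ℤ.* (1ℤ ℤ.* d) ℤ.+ s ℤ.+ -1ℤ ℤ.* s ≡ d
      rearrange = solve-∀
      solved : ∀ o d s → o ≡ 1ℤ → o ℤ.* (1ℤ ℤ.* d) ℤ.+ s ≡ 0ℤ → -1ℤ ℤ.* s ≡ d
      solved o d s ≡.refl e = ≡.trans (≡.sym (ℤ.+-identityˡ _))
        (≡.trans (≡.cong (λ z → z ℤ.+ -1ℤ ℤ.* s) (≡.sym e)) (rearrange d s))

    copies : (Fin n → Column) → ℕ
    copies W = ∣ denominator W ∣

    multiplicity : (Fin n → Column) → Fin n → ℕ
    multiplicity W r = units (W r) ℕ.* ∣ numerator W r ∣

    bins : (Fin n → Column) → ℕ
    bins W = ℕΣ.sum (multiplicity W)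

    -- The last condition says that the Cramer weights, numerator over denominator, are nonnegative.
    -- Neither `t` nor weights occur, so the test is decidable and common to all targets.
    Good : (Fin n → Column) → Set _
    Good W = (∀ j → Valid (W j)) × denominator W ≢ 0ℤ × ∀ r → 0ℤ ℤ.≤ denominator W ℤ.* numerator W r

    good? : ∀ W → Dec (Good W)
    good? W = Fin.all? (λ j → load (households (W j)) ≤? S) ×-dec ¬? (denominator W ℤ.≟ 0ℤ)
      ×-dec Fin.all? (λ r → 0ℤ ℤ.≤? denominator W ℤ.* numerator W r)

    copies>0 : ∀ {W} → Good W → 0# < copies W · 1#
    copies>0 {W} (_ , d≢0 , _) with copies W in eq
    ... | zero  = ⊥-elim (d≢0 (ℤ.∣i∣≡0⇒i≡0 eq))
    ... | suc k = 0<1+n·1 k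

    ratio : (Fin n → Column) → Carrier
    ratio W = bins W ÷ copies W

    castColumns : ∀ {b C} (σ : BasicSolution b C) W → (∀ j → BasicSolution.columns σ j ≡ W j) →
      BasicSolution b C
    castColumns σ W e = record
      { columns     = W
      ; valid       = λ j → ≡.subst Valid (e j) (valid j)
      ; det≢0       = λ d≡0 → det≢0 (≡.trans (det-cong λ i j → ≡.cong (λ v → entry v i) (e j)) d≡0)
      ; independent = λ a ka → independent a λ i → trans (same i a) (ka i)
      ; weight      = weight
      ; weight≥0    = weight≥0
      ; solves      = λ i → trans (sym (same i weight)) (solves i)
      ; cheap       = ≤-trans (≤-reflexive (sum-cong-≋ λ j →
          reflexive (≡.cong (λ v → units v · 1# * weight j) (≡.sym (e j))))) cheap
      }
      where
      open BasicSolution σ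
      same : ∀ i a → row columns i ⊙ a ≈ row W i ⊙ a
      same i a = sum-cong-≋ λ j → reflexive (≡.cong (λ v → ι (entry v i) * a j) (e j))

    -- Both `- t` followed by the weights and the vector of cofactors lie in the kernel of the ones
    -- column followed by the basis, and that kernel is a line.
    basic-weights : ∀ {t C} (σ : BasicSolution (λ _ → t) C) → let open BasicSolution σ in
      ∀ r → ι (denominator columns) * weight r ≈ t * ι (numerator columns r)
    basic-weights {t} σ r = begin
      ι (denominator columns) * weight r         ≡⟨ ≡.cong (λ d → ι d * weight r) (ℤ.*-identityˡ (denominator columns)) ⟨
      ι (cof zero) * weight r                    ≈⟨ kernel-line {withTarget columns} {a} {ι ∘ cof} independent kernel
                                                     (ι-kernel (withTarget columns) cof (cofactor-kernel (matrix (withTarget columns)))) (suc r) ⟩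
      - t * ι (cof (suc r))                      ≈⟨ solve 2 (λ t x → :- t :* x := t :* (:- x)) refl t _ ⟩
      t * - ι (cof (suc r))                      ≈⟨ *-congˡ (ι-neg (cof (suc r))) ⟨
      t * ι (numerator columns r)                ∎
      where
      open BasicSolution σ
      open ≈-Reasoning
      cof = cofactor (matrix (withTarget columns))
      a : Fin (suc n) → Carrier
      a = - t ∷ weight
      kernel : InKernel (withTarget columns) a
      kernel i = trans (+-cong (trans (*-congʳ (trans (reflexive (≡.cong ι (target-entry i))) ι-1)) (*-identityˡ _)) (solves i))
        (-‿inverseˡ t)

    -- By Cramer's rule, `t` times denominator times numerator is the squared denominator times a
    -- weight.
    basic⇒good : ∀ {t C} → 0# < t → (σ : BasicSolution (λ _ → t) C) → Good (BasicSolution.columns σ)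
    basic⇒good {t} 0<t σ = valid , det≢0 , λ r → 0≤ι⇒0≤ (*-cancelˡ-≤ 0<t (nonneg r))
      where
      open BasicSolution σ
      open ≤-Reasoning
      square≥0 : ∀ x → 0# ≤ x * x
      square≥0 x with total 0# x
      ... | inj₁ 0≤x = *-nonneg 0≤x 0≤x
      ... | inj₂ x≤0 = ≤-trans (*-nonneg (x≤0⇒0≤-x x≤0) (x≤0⇒0≤-x x≤0))
        (≤-reflexive (solve 1 (λ x → :- x :* :- x := x :* x) refl x))
      nonneg : ∀ r → t * 0# ≤ t * ι (denominator columns ℤ.* numerator columns r)
      nonneg r = begin
        t * 0#                                         ≈⟨ zeroʳ t ⟩
        0#                                             ≤⟨ *-nonneg (square≥0 d) (weight≥0 r) ⟩
        d * d * weight r                               ≈⟨ *-assoc d d (weight r) ⟩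
        d * (d * weight r)                             ≈⟨ *-congˡ (basic-weights σ r) ⟩
        d * (t * x)                                    ≈⟨ solve 3 (λ d t x → d :* (t :* x) := t :* (d :* x)) refl d t x ⟩
        t * (d * x)                                    ≈⟨ *-congˡ (ι-* (denominator columns) (numerator columns r)) ⟨
        t * ι (denominator columns ℤ.* numerator columns r) ∎
        where
        d = ι (denominator columns)
        x = ι (numerator columns r)

    basic-ratio : ∀ {t C} → 0# < t → (σ : BasicSolution (λ _ → t) C) → t * ratio (BasicSolution.columns σ) ≤ C
    basic-ratio {t} {C} 0<t σ = *-cancelˡ-≤ k>0 (begin
      k * (t * ratio columns)                           ≈⟨ solve 3 (λ k t x → k :* (t :* x) := t :* (k :* x)) refl k t _ ⟩
      t * (k * ratio columns)                           ≈⟨ *-congˡ (y*x/y≈x k>0) ⟩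
      t * (bins columns · 1#)                           ≈⟨ *-congˡ (ι-sum-ℕ (multiplicity columns)) ⟩
      t * sum (λ r → multiplicity columns r · 1#)       ≈⟨ *-distribˡ-sum t (λ r → multiplicity columns r · 1#) ⟩
      sum (λ r → t * (multiplicity columns r · 1#))     ≈⟨ sum-cong-≋ weigh ⟨
      (λ r → units (columns r) · 1#) ⊙ (λ r → k * weight r) ≈⟨ ⊙-* (λ r → units (columns r) · 1#) k weight ⟩
      k * (λ r → units (columns r) · 1#) ⊙ weight       ≤⟨ *-monoˡ-≤ (inj₁ k>0) cheap ⟩
      k * C                                             ∎)
      where
      open BasicSolution σ
      open ≤-Reasoning
      good = basic⇒good 0<t σ
      k = copies columns · 1#
      k>0 = copies>0 {columns} good
      scaled : ∀ r → k * weight r ≈ t * (∣ numerator columns r ∣ · 1#)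
      scaled r with absUnit (proj₁ (proj₂ good))
      ... | u , d≡ , x≡ = begin-equality
        ι (+ ∣ d ∣) * weight r       ≡⟨ ≡.cong (λ z → ι z * weight r) d≡ ⟩
        ι (u ℤ.* d) * weight r       ≈⟨ *-congʳ (ι-* u d) ⟩
        ι u * ι d * weight r         ≈⟨ *-assoc (ι u) (ι d) (weight r) ⟩
        ι u * (ι d * weight r)       ≈⟨ *-congˡ (basic-weights σ r) ⟩
        ι u * (t * ι x)              ≈⟨ solve 3 (λ u t x → u :* (t :* x) := t :* (u :* x)) refl (ι u) t (ι x) ⟩
        t * (ι u * ι x)              ≈⟨ *-congˡ (ι-* u x) ⟨
        t * ι (u ℤ.* x)              ≡⟨ ≡.cong (λ z → t * ι z) (x≡ {x} (proj₂ (proj₂ good) r)) ⟨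
        t * ι (+ ∣ x ∣)              ∎
        where
        d = denominator columns
        x = numerator columns r
      weigh : ∀ r → units (columns r) · 1# * (k * weight r) ≈ t * (multiplicity columns r · 1#)
      weigh r = begin-equality
        u * (k * weight r)           ≈⟨ *-congˡ (scaled r) ⟩
        u * (t * x)                  ≈⟨ solve 3 (λ u t x → u :* (t :* x) := t :* (u :* x)) refl u t x ⟩
        t * (u * x)                  ≈⟨ *-congˡ (Mult.×1-homo-* (units (columns r)) ∣ numerator columns r ∣) ⟨
        t * (multiplicity columns r · 1#) ∎
        where
        u = units (columns r) · 1#
        x = ∣ numerator columns r ∣ · 1#

    -- The search ranges over vectors of columns, and a column function agrees with its table only
    -- pointwise.
    tabulated : ∀ {b C} → BasicSolution b C → BasicSolution b C
    tabulated σ = castColumns σ (lookup (tabulate columns)) λ j → ≡.sym (lookup∘tabulate columns j)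
      where open BasicSolution σ

    -- The minimiser may be the starting value of the search, which therefore has to be good; hence
    -- the solution taken as an argument. Note that `W` is fixed before the inner `t` and `C`.
    optimalColumns : ∀ {t C} → 0# < t → BasicSolution (λ _ → t) C →
      ∃[ W ] Good W × ∀ {t C} → 0# < t → BasicSolution (λ _ → t) C → t * ratio W ≤ C
    optimalColumns 0<t₀ σ₀ = lookup best , Extrema.argmin-all (ratio ∘ lookup) {P = Good ∘ lookup} (basic⇒good 0<t₀ (tabulated σ₀))
        (all-filter (good? ∘ lookup) candidates) ,
      λ {t} 0<t σ → ≤-trans (*-monoˡ-≤ (inj₁ 0<t) (minimal {tabulate (BasicSolution.columns σ)} (basic⇒good 0<t (tabulated σ)))) (basic-ratio 0<t (tabulated σ))
      where
      initial = tabulate (BasicSolution.columns σ₀)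
      candidates = vectors allColumns n
      best = Extrema.argmin (ratio ∘ lookup) initial (filter (good? ∘ lookup) candidates)
      minimal : ∀ {v} → Good (lookup v) → ratio (lookup best) ≤ ratio (lookup v)
      minimal {v} good = All.lookup (Extrema.f[argmin]≤f[xs] {f = ratio ∘ lookup} initial (filter (good? ∘ lookup) candidates))
        (∈-filter⁺ (good? ∘ lookup) (∈-vectors ∈-allColumns v) good)

    column-01 : ∀ v → ∃[ s ] ∣ s ∣ ≡ 1 × ∀ i → ∃[ b ] (b ≡ 0ℤ ⊎ b ≡ 1ℤ) × entry v i ≡ s ℤ.* b
    column-01 (inj₁ A) = 1ℤ , ≡.refl , λ i → indicator (lookup A i) , indicator-01 (lookup A i) , ≡.sym (ℤ.*-identityˡ _)
    column-01 (inj₂ l) = -1ℤ , ≡.refl , λ i → indicator (does (l Fin.≟ i)) , indicator-01 (does (l Fin.≟ i)) , slack (does (l Fin.≟ i))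
      where
      slack : ∀ b → (if b then -1ℤ else 0ℤ) ≡ -1ℤ ℤ.* indicator b
      slack true  = ≡.refl
      slack false = ≡.refl

    copies≤maxDet01 : ∀ {a} → IsMaxDet01 n a → ∀ W → + copies W ℤ.≤ a
    copies≤maxDet01 max W with det-∣column∣ (matrix W) (column-01 ∘ W)
    ... | N , zo , e = ≡.subst (λ k → + k ℤ.≤ _) (≡.sym e) (∣det∣≤maxDet01 max N zo)

  -- Packings and schedules as fractional covers

  sum-single′ : ∀ {n} (f : Fin n → Carrier) i → sum (λ j → if does (i Fin.≟ j) then f j else 0#) ≈ f i
  sum-single′ {suc n} f zero    = trans (+-congˡ (sum-replicate-zero n)) (+-identityʳ _)
  sum-single′ {suc n} f (suc i) = trans (+-identityˡ _) (sum-single′ (f ∘ suc) i)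

  -- Injectivity leaves at most one nonzero term. This reconciles `capacity`, which counts copies,
  -- with `contents`, which records membership.
  sum-fibre : ∀ {k m} {g : Fin k → Fin m} → Injective _≡_ _≡_ g → ∀ b x →
    sum (λ j → if does (g j Fin.≟ b) then x else 0#) ≈ (if does (Fin.any? λ j → g j Fin.≟ b) then x else 0#)
  sum-fibre {k} {g = g} inj b x with Fin.any? (λ j → g j Fin.≟ b)
  ... | yes (j₀ , ≡.refl) = trans (sum-cong-≋ λ j → reflexive (≡.cong (if_then x else 0#)
          (does-⇔ (mk⇔ inj (≡.cong g)) (g j Fin.≟ g j₀) (j Fin.≟ j₀)))) (sum-single (λ _ → x) j₀)
  ... | no ∄j = trans (sum-cong-≋ λ j → reflexive (≡.cong (if_then x else 0#)
          (dec-false (g j Fin.≟ b) λ e → ∄j (j , e)))) (sum-replicate-zero k)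

  sum-fibre-≤ : ∀ {k m} {g : Fin k → Fin m} → Injective _≡_ _≡_ g → (P : Fin m → Bool) →
    (∀ j → P (g j) ≡ true) → ∀ {x} → 0# ≤ x → ∀ b →
    sum (λ j → if does (g j Fin.≟ b) then x else 0#) ≤ (if P b then x else 0#)
  sum-fibre-≤ {g = g} inj P hit {x} 0≤x b = ≤-trans (≤-reflexive (sum-fibre inj b x)) compared
    where
    nonneg : ∀ q → 0# ≤ (if q then x else 0#)
    nonneg true  = 0≤x
    nonneg false = ≤-refl
    compared : (if does (Fin.any? λ j → g j Fin.≟ b) then x else 0#) ≤ (if P b then x else 0#)
    compared with Fin.any? (λ j → g j Fin.≟ b)
    ... | yes (j , ≡.refl) = ≤-reflexive (reflexive (≡.cong (if_then x else 0#) (≡.sym (hit j))))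
    ... | no _ = nonneg (P b)

  telescope : ∀ p (f : Fin (suc p) → Carrier) → sum (λ l → f (suc l) - f (inject₁ l)) ≈ f (fromℕ p) - f zero
  telescope zero    f = sym (-‿inverseʳ (f zero))
  telescope (suc p) f = trans (+-congˡ (telescope p (f ∘ suc)))
    (solve 3 (λ a b c → (b :- a) :+ (c :- b) := c :- a) refl (f zero) (f (suc zero)) (f (fromℕ (suc p))))

  module Packings {n : ℕ} (S : Carrier) (D : Fin n → Carrier) (T : Carrier)
    (0<S : 0# < S) (0<T : 0# < T) (0<D≤S : ∀ i → 0# < D i × D i ≤ S) where
    open ElectricityDivision F S D T
    open Columns S D T 0<S

    -- Supplies the starting basis of the search; singletons are feasible because each demand is at
    -- most `S`.
    singletons-basic : BasicSolution (λ _ → 1#) (sum {n} λ _ → 1#)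
    singletons-basic = coverBasis single feasible₁ (λ _ → 1#) (λ _ → inj₁ 0<1) covered
      where
      single : Fin n → Subset n
      single l = tabulate λ i → does (i Fin.≟ l)
      feasible₁ : ∀ l → load (single l) ≤ S
      feasible₁ l = ≤-trans (≤-reflexive (trans (sum-cong-≋ λ i → reflexive
        (≡.cong (if_then D i else 0#) (lookup∘tabulate (λ i → does (i Fin.≟ l)) i))) (sum-single D l))) (proj₂ (0<D≤S l))
      covered : ∀ i → 1# ≤ coverage single (λ _ → 1#) i
      covered i = ≤-reflexive (sym (trans (sum-cong-≋ λ l → reflexive
        (≡.cong (if_then 1# else 0#) (lookup∘tabulate (λ i → does (i Fin.≟ l)) i))) (sum-single′ (λ _ → 1#) i)))

    module _ {k m} (f : Packing k m) where

      lookup-contents : ∀ b i → lookup (contents f b) i ≡ does (Fin.any? λ j → bin f i j Fin.≟ b)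
      lookup-contents b i = lookup∘tabulate _ i

      load-contents : ∀ b → load (contents f b) ≤ S
      load-contents b = ≤-trans (≤-reflexive (sum-cong-≋ λ i →
        trans (reflexive (≡.cong (if_then D i else 0#) (lookup-contents b i)))
          (sym (sum-fibre (distinct f i) b (D i))))) (capacity f b)

      coverage-contents : ∀ x i → coverage (contents f) (λ _ → x) i ≈ k · x
      coverage-contents x i = begin
        coverage (contents f) (λ _ → x) i
          ≈⟨ sum-cong-≋ (λ b → reflexive (≡.cong (if_then x else 0#) (lookup-contents b i))) ⟩
        sum (λ b → if does (Fin.any? λ j → bin f i j Fin.≟ b) then x else 0#)
          ≈⟨ sum-cong-≋ (λ b → sum-fibre (distinct f i) b x) ⟨
        sum (λ b → sum λ j → if does (bin f i j Fin.≟ b) then x else 0#)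
          ≈⟨ ∑-comm (λ b j → if does (bin f i j Fin.≟ b) then x else 0#) ⟩
        sum (λ j → sum λ b → if does (bin f i j Fin.≟ b) then x else 0#)
          ≈⟨ sum-cong-≋ (λ j → sum-single′ (λ _ → x) (bin f i j)) ⟩
        sum {k} (λ _ → x)
          ≈⟨ sum-replicate k ⟩
        k · x ∎
        where open ≈-Reasoning

      packing-basic : BasicSolution (λ _ → k · 1#) (m · 1#)
      packing-basic = castBasic (λ _ → refl) (≤-reflexive (sum-replicate m))
        (coverBasis (contents f) load-contents (λ _ → 1#) (λ _ → inj₁ 0<1)
          λ i → ≤-reflexive (sym (coverage-contents 1# i)))

    -- A household may lie in more than `k` of the sets. Choosing `k` of them only removes items
    -- from bins, and positive demands make the loads go down.
    coverPacking : ∀ {k m} (content : Fin m → Subset n) → (∀ b → load (content b) ≤ S) →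
      (∀ i → k ℕ.≤ count λ b → lookup (content b) i) → Packing k m
    coverPacking {k} content feasible enough = record
      { bin      = λ i → proj₁ (chosen i)
      ; distinct = λ i → proj₁ (proj₂ (chosen i))
      ; capacity = λ b → ≤-trans (sum-mono-≤ λ i → sum-fibre-≤ (proj₁ (proj₂ (chosen i)))
          (λ b → lookup (content b) i) (proj₂ (proj₂ (chosen i))) (inj₁ (proj₁ (0<D≤S i))) b) (feasible b)
      }
      where
      chosen : ∀ i → ∃[ g ] Injective _≡_ _≡_ g × ∀ (j : Fin k) → lookup (content (g j)) i ≡ true
      chosen i = pick (λ b → lookup (content b) i) (enough i)

    module _ {W : Fin n → Column} (good : Good W) where

      content : Fin (bins W) → Subset n
      content b = households (W (block (multiplicity W) b))

      -- Cramer's rule in absolute values writes `k` as the signed coverage of `i`. Slack columns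
      -- contribute at most zero to it, so the sets alone cover `i` at least `k` times.
      enough : ∀ i → copies W ℕ.≤ count λ b → lookup (content b) i
      enough i with absUnit (proj₁ (proj₂ good))
      ... | u , d≡ , x≡ = ℤ.drop‿+≤+ (ℤ.≤-trans (ℤ.≤-reflexive solved) (ℤ.≤-trans (ℤsum-mono-≤ dominated)
        (ℤ.≤-reflexive (≡.trans (≡.sym (pos-sum λ r → multiplicity W r ℕ.* hit r))
          (≡.cong +_ (≡.sym (sum-block (multiplicity W) hit)))))))
        where
        hit : Fin n → ℕ
        hit r = if lookup (households (W r)) i then 1 else 0
        solved : + copies W ≡ ℤΣ.sum λ r → matrix W i r ℤ.* + ∣ numerator W r ∣
        solved = ≡.trans d≡ (≡.trans (≡.cong (u ℤ.*_) (≡.sym (cramer W i)))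
          (≡.trans (ℤΣ.*-distribˡ-sum u λ r → matrix W i r ℤ.* numerator W r)
            (ℤΣ.sum-cong-≗ λ r → ≡.trans (lemma u (matrix W i r) (numerator W r))
              (≡.cong (matrix W i r ℤ.*_) (≡.sym (x≡ (proj₂ (proj₂ good) r)))))))
          where
          lemma : ∀ u a x → u ℤ.* (a ℤ.* x) ≡ a ℤ.* (u ℤ.* x)
          lemma = solve-∀
        dominates : ∀ v q → entry v i ℤ.* + q ℤ.≤ + (units v ℕ.* q ℕ.* (if lookup (households v) i then 1 else 0))
        dominates (inj₁ A) q with lookup A i
        ... | true  = ℤ.≤-reflexive (≡.trans (ℤ.*-identityˡ (+ q)) (≡.cong +_ (≡.sym (≡.trans (ℕ.*-identityʳ (1 ℕ.* q)) (ℕ.*-identityˡ q)))))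
        ... | false = ℤ.+≤+ ℕ.z≤n
        dominates (inj₂ l) q with does (l Fin.≟ i)
        ... | false = ℤ.+≤+ ℕ.z≤n
        ... | true  = ℤ.≤-trans (ℤ.≤-reflexive (ℤ.-1*i≡-i (+ q))) (ℤ.neg-≤-pos {q})
        dominated : ∀ r → matrix W i r ℤ.* + ∣ numerator W r ∣ ℤ.≤ + (multiplicity W r ℕ.* hit r)
        dominated r = dominates (W r) ∣ numerator W r ∣

      goodPacking : Packing (copies W) (bins W)
      goodPacking = coverPacking content (λ b → proj₁ good (block (multiplicity W) b)) enough

    0<1÷m·T : ∀ m → 0# < (1 ÷ suc m) * T
    0<1÷m·T m = *-pos (*-pos (0<1+n·1 0) (0<x⁻¹ (0<1+n·1 m))) 0<T

    module _ {k m} (f : Packing k (suc m)) where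

      private
        h = (1 ÷ suc m) * T
        M = suc m · 1#

      M·h≈T : suc m · h ≈ T
      M·h≈T = begin
        suc m · h                  ≈⟨ Mult.×-congʳ (suc m) (*-identityˡ h) ⟨
        suc m · (1# * h)           ≈⟨ Mult.×-assoc-* (suc m) 1# h ⟨
        M * h                      ≈⟨ *-congˡ (*-congʳ (*-congʳ ι-1)) ⟩
        M * (1# * M ⁻¹ * T)        ≈⟨ solve 4 (λ m o i t → m :* (o :* i :* t) := m :* (t :* i) :* o) refl M 1# (M ⁻¹) T ⟩
        M * (T / M) * 1#           ≈⟨ *-identityʳ _ ⟩
        M * (T / M)                ≈⟨ y*x/y≈x (0<1+n·1 m) ⟩
        T                          ∎
        where open ≈-Reasoning

      duration-step : ∀ (l : Fin (suc m)) → toℕ (suc l) · h - toℕ (inject₁ l) · h ≈ h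
      duration-step l = trans (+-congˡ (-‿cong (reflexive (≡.cong (_· h) (Fin.toℕ-inject₁ l)))))
        (solve 2 (λ h x → h :+ x :- x := h) refl h (toℕ l · h))

      equalSchedule : Schedule (suc m)
      equalSchedule = record
        { breakpoint = λ l → toℕ l · h
        ; start      = refl
        ; end        = trans (reflexive (≡.cong (_· h) (Fin.toℕ-fromℕ (suc m)))) M·h≈T
        ; increasing = λ l → 0<y-x⇒x<y (<-respʳ-≈ (sym (duration-step l)) (0<1÷m·T m))
        ; connected  = contents f
        ; feasible   = load-contents f
        }

      equalSchedule-follows : Follows equalSchedule f
      equalSchedule-follows l = ≡.refl , duration-step l

      equalSchedule-time : ∀ i → connectionTime equalSchedule i / T ≈ k ÷ suc m
      equalSchedule-time i = *-cancelˡ-≈ 0<T (trans (y*x/y≈x 0<T) (begin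
        connectionTime equalSchedule i          ≈⟨ sum-cong-≋ (λ l → case (lookup (contents f l) i) (duration-step l)) ⟩
        coverage (contents f) (λ _ → h) i       ≈⟨ coverage-contents f h i ⟩
        k · h                                   ≈⟨ Mult.×-congʳ k (*-identityˡ h) ⟨
        k · (1# * h)                            ≈⟨ Mult.×-assoc-* k 1# h ⟨
        k · 1# * h                              ≈⟨ *-congˡ (*-congʳ (*-congʳ ι-1)) ⟩
        k · 1# * (1# * M ⁻¹ * T)                ≈⟨ *-congˡ (*-congʳ (*-identityˡ (M ⁻¹))) ⟩
        k · 1# * (M ⁻¹ * T)                     ≈⟨ solve 3 (λ k i t → k :* (i :* t) := t :* (k :* i)) refl (k · 1#) (M ⁻¹) T ⟩
        T * (k ÷ suc m)                         ∎))
        where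
        open ≈-Reasoning
        case : ∀ b {x y} → x ≈ y → (if b then x else 0#) ≈ (if b then y else 0#)
        case true  e = e
        case false _ = refl

      -- All households are connected equally long; `i₀` witnesses that the minimum is attained.
      equalSchedule-value : Fin n → IsEgalitarianValue equalSchedule (k ÷ suc m)
      equalSchedule-value i₀ = (i₀ , sym (equalSchedule-time i₀)) ,
        λ { x (i , x≈) → ≤-reflexive (sym (trans x≈ (equalSchedule-time i))) }

    schedule-basic : ∀ {p} (σ : Schedule p) {v} → IsEgalitarianValue σ v → BasicSolution (λ _ → v * T) T
    schedule-basic {p} σ {v} (_ , least) = castBasic (λ _ → refl) (≤-reflexive total-duration)
      (coverBasis (connected σ) (feasible σ) (duration σ)
        (λ l → x≤y⇒0≤y-x (inj₁ (increasing σ l))) covered)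
      where
      total-duration : sum (duration σ) ≈ T
      total-duration = trans (telescope p (breakpoint σ))
        (trans (+-cong (end σ) (trans (-‿cong (Schedule.start σ)) -0#≈0#)) (+-identityʳ T))
      covered : ∀ i → v * T ≤ connectionTime σ i
      covered i = ≤-trans (≤-reflexive (*-comm v T)) (≤-trans
        (*-monoˡ-≤ (inj₁ 0<T) (least _ (i , refl))) (≤-reflexive (y*x/y≈x 0<T)))

    Conclusion : ℕ → Set _
    Conclusion k = 1 ℕ.≤ k × (∃[ a ] IsMaxDet01 n a × + k ℤ.≤ a) ×
      (∃[ m ] IsOPT k m × IsEgalitarianConnectionTime (k ÷ m) ×
      ((f : Packing k m) → ∃[ σ ] Follows σ f × IsEgalitarianValue σ (k ÷ m)))

    conclude : Fin n → ∀ k m → 0# < k · 1# → (∃[ a ] IsMaxDet01 n a × + k ℤ.≤ a) → Packing k m →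
      (∀ {t C} → 0# < t → BasicSolution (λ _ → t) C → t * (m ÷ k) ≤ C) → Conclusion k
    conclude i₀ zero    m       k>0 _ _ _ = ⊥-elim (irrefl refl k>0)
    -- The first copy of `i₀` would need a bin.
    conclude i₀ (suc k) zero    _ _ f _ with () ← bin f i₀ zero
    conclude i₀ (suc k) (suc m) _ bounded f optimal = ℕ.s≤s ℕ.z≤n , bounded ,
      suc m , (f , λ m′ g → ·1-cancel-≤ (suc m) m′ (fewest g)) ,
      ((_ , equalSchedule f , equalSchedule-value f i₀) , λ { v (p , σ , value) → upper σ value }) ,
      λ g → equalSchedule g , equalSchedule-follows g , equalSchedule-value g i₀
        where
        K = suc k · 1#
        M = suc m · 1#
        -- Optimality at target `K` and budget `m′ · 1#`: the factor `K` cancels the denominator of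
        -- the ratio.
        fewest : ∀ {m′} → Packing (suc k) m′ → M ≤ m′ · 1#
        fewest g = ≤-trans (≤-reflexive (sym (y*x/y≈x (0<1+n·1 k)))) (optimal (0<1+n·1 k) (packing-basic g))
        k÷m>0 : 0# < suc k ÷ suc m
        k÷m>0 = *-pos (0<1+n·1 k) (0<x⁻¹ (0<1+n·1 m))
        upper : ∀ {p v} (σ : Schedule p) → IsEgalitarianValue σ v → v ≤ suc k ÷ suc m
        -- A schedule may leave a household unserved, whereas `optimal` wants a positive target
        -- `v * T`; the assumption that `v` exceeds the ratio provides it.
        upper {v = v} σ value = ≮⇒≥ λ k/m<v → ≤⇒≯ (v≤k/m (<-trans k÷m>0 k/m<v)) k/m<v
          where
          open ≤-Reasoning
          v≤k/m : 0# < v → v ≤ suc k ÷ suc m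
          v≤k/m 0<v = *-cancelˡ-≤ (*-pos (0<1+n·1 m) 0<T) (begin
            M * T * v                        ≈⟨ solve 3 (λ m t v → m :* t :* v := v :* t :* m) refl M T v ⟩
            v * T * M                        ≈⟨ *-congˡ (y*x/y≈x (0<1+n·1 k)) ⟨
            v * T * (K * (M / K))            ≈⟨ solve 3 (λ a k x → a :* (k :* x) := k :* (a :* x)) refl (v * T) K (M / K) ⟩
            K * (v * T * (M / K))            ≤⟨ *-monoˡ-≤ (inj₁ (0<1+n·1 k)) (optimal (*-pos 0<v 0<T) (schedule-basic σ value)) ⟩
            K * T                            ≈⟨ *-congʳ (y*x/y≈x (0<1+n·1 m)) ⟨
            M * (K / M) * T                  ≈⟨ solve 3 (λ m t x → m :* x :* t := m :* t :* x) refl M T (K / M) ⟩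
            M * T * (K / M)                  ∎)

    conclusion : Fin n → ∃[ k ] Conclusion k
    conclusion i₀ = select (optimalColumns 0<1 singletons-basic) (maxDet01 n)
      where
      select : (∃[ W ] Good W × ∀ {t C} → 0# < t → BasicSolution (λ _ → t) C → t * ratio W ≤ C) →
        (∃[ a ] IsMaxDet01 n a) → ∃[ k ] Conclusion k
      select (W , good , optimal) (a , max) = copies W ,
        conclude i₀ (copies W) (bins W) (copies>0 {W} good) (a , max , copies≤maxDet01 max W) (goodPacking good) optimal

theorem1 : ∀ {c ℓ₁ ℓ₂} (F : OrderedField c ℓ₁ ℓ₂) (let open OrderedField F)
    (n : ℕ) .{{_ : NonZero n}}
    (S : Carrier) (D : Fin n → Carrier) (T : Carrier)
    (let open ElectricityDivision F S D T) →
    0# < S → 0# < T → (∀ i → 0# < D i × D i ≤ S) →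
    ∃[ k ] 1 ℕ.≤ k × (∃[ a ] IsMaxDet01 n a × + k ℤ.≤ a) ×
    (∃[ m ] IsOPT k m × IsEgalitarianConnectionTime (k ÷ m) ×
    ((f : Packing k m) → ∃[ σ ] Follows σ f × IsEgalitarianValue σ (k ÷ m)))
theorem1 F n S D T 0<S 0<T 0<D≤S =
  OverField.Packings.conclusion F S D T 0<S 0<T 0<D≤S (fromℕ< (ℕ.>-nonZero⁻¹ n))
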